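{- Let $p\in\mathbb N$, let $(\mathbf A_n)_{n\in\mathbb N}$ be a sequence of finite base structures and $(\mathbf G_n)_{n\in\mathbb N}$ a sequence of finite gadgets such that, for every $n$ and every $S\in L$, no tuple of $S^{\mathbf G_n}$ consists only of roots of $\mathbf G_n$. Suppose that the sequence of $L_*$-structures $(\mathbf A_n*\mathbf G_n)_n$ is $\mathrm{FO}^{\mathrm{loc}}_p(L_*)$-convergent. Then for every profile $\pi=(I,E_1,\dots,E_t)$ of a $p$-tuple that is non-trivial with respect to $(\mathbf A_n*\mathbf G_n)_n$ and every local $L_R$-formula $\phi$ with $|I|+(p-|I|)\,\mathrm{ar}(R)$ free variables, the sequence $\langle\phi|_\pi,\mathbf A_n\rangle$ converges.
   Context: Fix a purely relational first-order language $L$ (with equality, finite positive arities) and a relation symbol $R\notin L$ of arity $\mathrm{ar}(R)\ge1$. All structures are finite and nonempty; $V(\mathbf A)$ is the universe of $\mathbf A$. Base structures and gadgets. $L_R=L\cup\{R\}$; a base structure is an $L_R$-structure. $L_G$ is $L$ extended by constants $z_1,\dots,z_{\mathrm{ar}(R)}$; a gadget is an $L_G$-structure $\mathbf G$ in which the vertices $z_i^{\mathbf G}$ (the roots) are pairwise distinct. Gadget construction (with construction language). $L_*=L_R\cup\{\mathrm{Int},\mathrm{Ext},\rho\}$, with $\mathrm{Int},\mathrm{Ext}$ unary and $\rho$ a relation symbol of arity $\mathrm{ar}(R)+1$. $\mathbf A*\mathbf G$ is the $L_*$-structure with universe $\big(V(\mathbf A)\sqcup(R^{\mathbf A}\times V(\mathbf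 G))\big)/\!\sim$, where $\sim$ is generated by $e_i\sim(\boldsymbol e,z_i^{\mathbf G})$ for $\boldsymbol e\in R^{\mathbf A}$, $1\le i\le\mathrm{ar}(R)$. For $S\in L$ of arity $s$, $S^{\mathbf A*\mathbf G}=\{([a_1],\dots,[a_s]):(a_1,\dots,a_s)\in S^{\mathbf A}\}\cup\{([(\boldsymbol e,v_1)],\dots,[(\boldsymbol e,v_s)]):\boldsymbol e\in R^{\mathbf A},(v_1,\dots,v_s)\in S^{\mathbf G}\}$. Moreover $R^{\mathbf A*\mathbf G}=\{([a_1],\dots,[a_{\mathrm{ar}(R)}]):(a_1,\dots,a_{\mathrm{ar}(R)})\in R^{\mathbf A}\}$; $\mathrm{Int}^{\mathbf A*\mathbf G}$ is the set of internal vertices (classes containing a vertex of $\mathbf A$); $\mathrm{Ext}^{\mathbf A*\mathbf G}$ is its complement, the set of external vertices; and $\rho^{\mathbf A*\mathbf G}=\{([(\boldsymbol e,v)],[e_1],\dots,[e_{\mathrm{ar}(R)}]):[(\boldsymbol e,v)]\in\mathrm{Ext}^{\mathbf A*\mathbf G}\}$. For an external vertex $a=[(\boldsymbol e,v)]$ write $\rho(a)=\boldsymbol e$ (uniquely determined). Locality and convergence. Distances are in the Gaifman graph. A formula is local if for some $r\in\mathbb N_0$ its satisfaction by a tuple depends only on the substructure induced by the $r$-neighborhood of the free variables. $\mathrm{FO}^{\mathrm{loc}}_p(\lambda)$ is the set of local $\lambda$-formulas with free variables among $x_1,\dots,x_p$. For $p\ge1$, $\langle\phi,\mathbf A\rangle$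 is the probability that a uniformly random $p$-tuple of vertices of $\mathbf A$ satisfies $\phi$. A sequence $(\mathbf B_n)$ is $X$-convergent if $\langle\phi,\mathbf B_n\rangle$ converges for every $\phi\in X$. Profiles. The profile of a $p$-tuple $\boldsymbol a$ from $\mathbf A*\mathbf G$ is the ordered partition $(I,E_1,\dots,E_t)$ of $\{1,\dots,p\}$ with $I=\{i:a_i\text{ internal}\}$ (possibly empty) and $E_1,\dots,E_t$ the nonempty classes of the relation $\rho(a_i)=\rho(a_{i'})$ on indices of external vertices, listed by increasing minimal element. A profile $\pi$ is trivial w.r.t. $(\mathbf A_n*\mathbf G_n)_n$ if the probability that a uniformly random $p$-tuple from $\mathbf A_n*\mathbf G_n$ has profile $\pi$ tends to $0$; otherwise it is non-trivial. For a formula $\phi(\boldsymbol x_1,\dots,\boldsymbol x_p)$ where the block $\boldsymbol x_i$ is a single variable if $i\in I$ and an $\mathrm{ar}(R)$-tuple of variables if $i\notin I$, $\langle\phi|_\pi,\mathbf A\rangle$ is the conditional probability that $\mathbf A\models\phi(\boldsymbol b_1,\dots,\boldsymbol b_p)$ for uniformly random $\boldsymbol b_1,\dots,\boldsymbol b_p$ from $\mathbf A$ (vertices, resp. $\mathrm{ar}(R)$-tuples of vertices), given that $\boldsymbol b_i\in R^{\mathbf A}$ for all $i\notin I$ and, for $i,i'\notin I$, $\boldsymbol b_i=\boldsymbol b_{i'}$ iff $i,i'$ lie in a common $E_j$. Convergence of $\langle\phi|_\pi,\mathbf A_n\rangle$ concerns all sufficiently large $n$, for which the conditioning event has positive probability.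 -}

module Defs where

open import Axiom.ExcludedMiddle using (ExcludedMiddle)
open import Data.Empty using (⊥)
open import Data.Fin.Base using (Fin; zero; suc) renaming (_<_ to _<ᶠ_; _≤_ to _≤ᶠ_)
import Data.Fin.Properties as Fin
open import Data.Fin.Subset using (Subset; inside; outside; ∣_∣; Nonempty) renaming (_∈_ to _∈ˢ_; _∉_ to _∉ˢ_)
open import Data.Fin.Subset.Properties using (∣p∣≤n) renaming (_∈?_ to _∈ˢ?_)
import Data.Integer.Base as ℤ
open import Data.Irrelevant using ([_])
open import Data.List.Base as List using (List; []; _∷_; _++_; length; filter; cartesianProductWith)
open import Data.List.Membership.Propositional using (_∈_; find; lose)
open import Data.List.Membership.Propositional.Properties
  using (∈-cartesianProductWith⁺; ∈-cartesianProductWith⁻; ∈-map⁺; ∈-map⁻; ∈-++⁺ˡ; ∈-++⁺ʳ)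
open import Data.List.Relation.Unary.All using (All; []; _∷_)
open import Data.List.Relation.Unary.Any using (here; there; any?)
open import Data.List.Relation.Unary.AllPairs using ([]; _∷_)
open import Data.List.Relation.Unary.Unique.Propositional using (Unique)
import Data.List.Relation.Unary.Unique.Propositional.Properties as Uniq
open import Data.List.Relation.Unary.Enumerates.Setoid using (IsEnumeration)
open import Data.Nat.Base using (ℕ; zero; suc; NonZero; >-nonZero; >-nonZero⁻¹; _+_; _*_; _∸_; _≥_)
import Data.Nat.Properties as ℕ
open import Data.Product using (∃; ∃-syntax; _×_; _,_; proj₁; proj₂)
open import Data.Rational.Base using (ℚ; 0ℚ; _/_; _-_) renaming (∣_∣ to ∣_∣ᵠ; _<_ to _<ᵠ_; _≤_ to _≤ᵠ_)
import Data.Rational.Properties as ℚ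
open import Data.Refinement using (Refinement-syntax; value) renaming (_,_ to _,ʳ_)
open import Data.Sum.Base using (_⊎_; inj₁; inj₂)
open import Data.Vec.Base as Vec using (Vec; []; _∷_; lookup; take; drop)
open import Data.Vec.Membership.Propositional using () renaming (_∈_ to _∈ᵛ_)
import Data.Vec.Properties as Vec
open import Data.Vec.Relation.Unary.All using () renaming (All to Allᵛ)
open import Function.Base using (_∘_)
open import Function.Bundles using (_⇔_; mk⇔; Inverse; Equivalence)
open import Function.Definitions using (Injective)
open import Level using (0ℓ)
open import Relation.Binary.Bundles using (Setoid)
open import Relation.Binary.Construct.Closure.Equivalence as EqC using (EqClosure)
open import Relation.Binary.Definitions using (DecidableEquality)
import Relation.Binary.Construct.On as On
open import Relation.Binary.PropositionalEquality
  using (_≡_; _≢_; refl; cong; subst; setoid; isEquivalence; module ≡-Reasoning) renaming (sym to ≡-sym)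
open import Relation.Nullary using (¬_; Dec; yes; no; contradiction)
open import Relation.Nullary.Negation using (contradiction-irr)
open import Relation.Nullary.Decidable using (map′; ¬?; _×-dec_; _→-dec_; _⊎-dec_)
open import Relation.Unary using (Pred; Decidable)

Cauchy : (ℕ → ℚ) → Set
Cauchy q = ∀ ε → 0ℚ <ᵠ ε → ∃[ N ] ∀ m n → m ≥ N → n ≥ N → ∣ q m - q n ∣ᵠ <ᵠ ε

-- The quotient identifying Cauchy sequences with the same limit is not
-- formed: only the existence of a limit matters below.
record ℝ : Set where
  field
    approx : ℕ → ℚ
    cauchy : Cauchy approx

-- Implied by |q − x| < ε and implying |q − x| ≤ ε.
Within : ℚ → ℚ → ℝ → Set
Within ε q x = ∃[ K ] ∀ k → k ≥ K → ∣ q - ℝ.approx x k ∣ᵠ <ᵠ ε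

_⟶_ : (ℕ → ℚ) → ℝ → Set
q ⟶ x = ∀ ε → 0ℚ <ᵠ ε → ∃[ N ] ∀ n → n ≥ N → Within ε (q n) x

Converges : (ℕ → ℚ) → Set
Converges q = ∃[ x ] q ⟶ x

TendsToZero : (ℕ → ℚ) → Set
TendsToZero q = ∀ ε → 0ℚ <ᵠ ε → ∃[ N ] ∀ n → n ≥ N → ∣ q n ∣ᵠ <ᵠ ε

-- The negation of TendsToZero with the quantifiers dualised, i.e. in its
-- constructively informative form; classically it is the negation, as
-- the two lemmas below show.
DoesNotTendToZero : (ℕ → ℚ) → Set
DoesNotTendToZero q = ∃[ ε ] 0ℚ <ᵠ ε × ∀ N → ∃[ n ] n ≥ N × ε ≤ᵠ ∣ q n ∣ᵠ

doesNotTend⇒¬tends : ∀ q → DoesNotTendToZero q → ¬ TendsToZero q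
doesNotTend⇒¬tends q (ε , 0<ε , large) tends with tends ε 0<ε
... | N , small with large N
... | n , n≥N , ε≤ = ℚ.<-irrefl refl (ℚ.<-≤-trans (small n n≥N) ε≤)

¬tends⇒doesNotTend : ExcludedMiddle 0ℓ → ∀ q → ¬ TendsToZero q → DoesNotTendToZero q
¬tends⇒doesNotTend em q ¬tends with em {DoesNotTendToZero q}
... | yes large = large
... | no ¬large = contradiction tends ¬tends
  where
  tends : TendsToZero q
  tends ε 0<ε with em {∃[ N ] ∀ n → n ≥ N → ∣ q n ∣ᵠ <ᵠ ε}
  ... | yes small = small
  ... | no ¬small = contradiction (ε , 0<ε , beyond) ¬large
    where
    beyond : ∀ N → ∃[ n ] n ≥ N × ε ≤ᵠ ∣ q n ∣ᵠ
    beyond N with em {∃[ n ] n ≥ N × ε ≤ᵠ ∣ q n ∣ᵠ}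
    ... | yes b = b
    ... | no ¬b = contradiction
      (N , λ n n≥N → ℚ.≰⇒> (λ ε≤ → ¬b (n , n≥N , ε≤))) ¬small

record Finite (X : Set) : Set where
  field
    _≟_      : DecidableEquality X
    elements : List X
    complete : IsEnumeration (setoid X) elements
    unique   : Unique elements

∃? : ∀ {X} → Finite X → {P : Pred X 0ℓ} → Decidable P → Dec (∃ P)
∃? fin P? = map′ (λ p → let x , _ , px = find p in x , px)
                 (λ (x , px) → lose (Finite.complete fin x) px)
                 (any? P? (Finite.elements fin))

module _ {X : Set} (fin : Finite X) where
  open Finite fin

  tuples : ∀ n → List (Vec X n)
  tuples zero    = [] ∷ []
  tuples (suc n) = cartesianProductWith _∷_ elements (tuples n)

  finiteVec : ∀ n → Finite (Vec X n)
  finiteVec n = record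
    { _≟_      = Vec.≡-dec _≟_
    ; elements = tuples n
    ; complete = comp
    ; unique   = uniq n
    }
    where
    comp : ∀ {n} (v : Vec X n) → v ∈ tuples n
    comp []      = here refl
    comp (x ∷ v) = ∈-cartesianProductWith⁺ _∷_ (complete x) (comp v)
    uniq : ∀ n → Unique (tuples n)
    uniq zero    = [] ∷ []
    uniq (suc n) = Uniq.cartesianProductWith⁺ _∷_ Vec.∷-injective unique (uniq n)

  module _ {P : Pred X 0ℓ} (P? : Decidable P) where

    refineList : List X → List [ x ∈ X ∣ P x ]
    refineList []       = []
    refineList (x ∷ xs) with P? x
    ... | yes px = (x ,ʳ [ px ]) ∷ refineList xs
    ... | no _   = refineList xs

    refineList-complete : ∀ {xs} (y : [ x ∈ X ∣ P x ]) → value y ∈ xs → y ∈ refineList xs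
    refineList-complete {x ∷ _} y@(_ ,ʳ [ py ]) y∈ with P? x | y∈
    ... | yes _  | here refl = here refl
    ... | yes _  | there y∈′ = there (refineList-complete y y∈′)
    ... | no ¬px | here refl = contradiction-irr py ¬px
    ... | no _   | there y∈′ = refineList-complete y y∈′

    refineList-fresh : ∀ {xs} {y : [ x ∈ X ∣ P x ]} → All (value y ≢_) xs → All (y ≢_) (refineList xs)
    refineList-fresh {[]}     []         = []
    refineList-fresh {x ∷ xs} (y≢x ∷ y≢) with P? x
    ... | yes _ = (y≢x ∘ cong value) ∷ refineList-fresh y≢
    ... | no _  = refineList-fresh y≢

    refineList-unique : ∀ {xs} → Unique xs → Unique (refineList xs)
    refineList-unique {[]}     []         = []
    refineList-unique {x ∷ xs} (x≢ ∷ xs!) with P? x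
    ... | yes _ = refineList-fresh x≢ ∷ refineList-unique xs!
    ... | no _  = refineList-unique xs!

    finiteRefinement : Finite [ x ∈ X ∣ P x ]
    finiteRefinement = record
      { _≟_      = λ y z → map′ (λ { refl → refl }) (cong value) (value y ≟ value z)
      ; elements = refineList elements
      ; complete = λ y → refineList-complete y (complete (value y))
      ; unique   = refineList-unique unique
      }

-- The probability that a uniformly random entry of a list satisfies P; the
-- value on the empty list is a dummy.
proportion : ∀ {X : Set} {P : Pred X 0ℓ} → Decidable P → List X → ℚ
proportion P? []          = 0ℚ
proportion P? xs@(_ ∷ _) = ℤ.+ length (filter P? xs) / length xs

record Language : Set₁ where
  field
    Sym           : Set
    arity         : Sym → ℕ
    arity-nonZero : ∀ S → NonZero (arity S)

record Structure (L : Language) : Set₁ where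
  open Language L
  field
    Carrier    : Set
    finite     : Finite Carrier
    inhabitant : Carrier
    rel        : (S : Sym) → Pred (Vec Carrier (arity S)) 0ℓ
    rel?       : (S : Sym) → Decidable (rel S)

-- Formula L n: formulas with free variables among x₀ , … , xₙ₋₁.  The
-- quantifier binds variable 0.  The other connectives are definable since
-- satisfaction in finite structures is decidable.
data Formula (L : Language) (n : ℕ) : Set where
  _≐_   : (x y : Fin n) → Formula L n
  _⦅_⦆ : (S : Language.Sym L) → Vec (Fin n) (Language.arity L S) → Formula L n
  ¬′_   : Formula L n → Formula L n
  _∧′_ : (φ ψ : Formula L n) → Formula L n
  ∃′_   : Formula L (suc n) → Formula L n

module _ {L : Language} (A : Structure L) where
  open Structure A

  infix 4 _⊨_[_]

  _⊨_[_] : ∀ {n} → Formula L n → Vec Carrier n → Set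
  _⊨_[_] (x ≐ y)    a = lookup a x ≡ lookup a y
  _⊨_[_] (S ⦅ xs ⦆) a = rel S (Vec.map (lookup a) xs)
  _⊨_[_] (¬′ φ)     a = ¬ _⊨_[_] φ a
  _⊨_[_] (φ ∧′ ψ)   a = _⊨_[_] φ a × _⊨_[_] ψ a
  _⊨_[_] (∃′ φ)     a = ∃[ v ] _⊨_[_] φ (v ∷ a)

  sat? : ∀ {n} (φ : Formula L n) → Decidable (_⊨_[_] φ)
  sat? (x ≐ y)    a = Finite._≟_ finite (lookup a x) (lookup a y)
  sat? (S ⦅ xs ⦆) a = rel? S (Vec.map (lookup a) xs)
  sat? (¬′ φ)     a = ¬? (sat? φ a)
  sat? (φ ∧′ ψ)   a = sat? φ a ×-dec sat? ψ a
  sat? (∃′ φ)     a = ∃? finite (λ v → sat? φ (v ∷ a))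

  Adjacent : Carrier → Carrier → Set
  Adjacent u v = u ≢ v × ∃[ S ] ∃[ t ] rel S t × u ∈ᵛ t × v ∈ᵛ t

  data Neighbourhood {n} (a : Vec Carrier n) : ℕ → Carrier → Set where
    centre : ∀ {r} i → Neighbourhood a r (lookup a i)
    step   : ∀ {r u v} → Neighbourhood a r u → Adjacent u v → Neighbourhood a (suc r) v

  -- The vertex set of the induced substructure; the proof of membership is
  -- ignored by equality.
  NeighbourhoodSetoid : ∀ {n} → Vec Carrier n → ℕ → Setoid 0ℓ 0ℓ
  NeighbourhoodSetoid a r = On.setoid {B = ∃ (Neighbourhood a r)} (setoid Carrier) proj₁

⟨_,_⟩ : ∀ {L n} → Formula L n → Structure L → ℚ
⟨_,_⟩ {n = n} φ A = proportion (sat? A φ) (tuples (Structure.finite A) n)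

-- Isomorphisms between the substructures induced by the r-neighbourhoods of a
-- and b, carrying a to b.
record NeighbourhoodIso {L} (A B : Structure L) {n} (r : ℕ)
       (a : Vec (Structure.Carrier A) n) (b : Vec (Structure.Carrier B) n) : Set where
  field
    iso : Inverse (NeighbourhoodSetoid A a r) (NeighbourhoodSetoid B b r)
  open Inverse iso public using (to)
  field
    preserves : ∀ S (t : Vec (∃ (Neighbourhood A a r)) (Language.arity L S)) →
      Structure.rel A S (Vec.map proj₁ t) ⇔ Structure.rel B S (Vec.map (proj₁ ∘ to) t)
    centres   : ∀ i → proj₁ (to (lookup a i , centre i)) ≡ lookup b i

Local : ∀ {L n} → Formula L n → Set₁
Local {L} φ = ∃[ r ] ∀ (A B : Structure L) a b → NeighbourhoodIso A B r a b →
  _⊨_[_] A φ a ⇔ _⊨_[_] B φ b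

FOloc-Convergent : ∀ {L} → ℕ → (ℕ → Structure L) → Set₁
FOloc-Convergent {L} p B = (φ : Formula L p) → Local φ → Converges (λ n → ⟨ φ , B n ⟩)

record Profile (p : ℕ) : Set where
  field
    I          : Subset p
    {t}        : ℕ
    E          : Fin t → Subset p
    cover      : ∀ i → i ∈ˢ I ⊎ ∃[ j ] i ∈ˢ E j
    I-disjoint : ∀ i j → i ∈ˢ I → i ∉ˢ E j
    E-disjoint : ∀ i j j′ → i ∈ˢ E j → i ∈ˢ E j′ → j ≡ j′
    nonempty   : ∀ j → Nonempty (E j)

  IsMin : Fin p → Fin t → Set
  IsMin i j = i ∈ˢ E j × ∀ i′ → i′ ∈ˢ E j → i ≤ᶠ i′

  field
    ordered    : ∀ {j j′ i i′} → j <ᶠ j′ → IsMin i j → IsMin i′ j′ → i <ᶠ i′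

  SameClass : Fin p → Fin p → Set
  SameClass i i′ = ∃[ j ] i ∈ˢ E j × i′ ∈ˢ E j

  sameClass? : ∀ i i′ → Dec (SameClass i i′)
  sameClass? i i′ = Fin.any? (λ j → (i ∈ˢ? E j) ×-dec (i′ ∈ˢ? E j))

_⇔-dec_ : ∀ {P Q : Set} → Dec P → Dec Q → Dec (P ⇔ Q)
P? ⇔-dec Q? = map′ (λ (f , g) → mk⇔ f g) (λ e → Equivalence.to e , Equivalence.from e)
                   ((P? →-dec Q?) ×-dec (Q? →-dec P?))

data BaseSym (Sym : Set) : Set where
  sym : Sym → BaseSym Sym
  R   : BaseSym Sym

data StarSym (Sym : Set) : Set where
  sym         : Sym → StarSym Sym
  R Int Ext ρ : StarSym Sym

module _ (L : Language) (k : ℕ) .{{_ : NonZero k}} where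
  open Language L

  BaseLanguage : Language
  BaseLanguage = record
    { Sym           = BaseSym Sym
    ; arity         = λ { (sym S) → arity S ; R → k }
    ; arity-nonZero = λ { (sym S) → arity-nonZero S ; R → >-nonZero (>-nonZero⁻¹ k) }
    }

  StarLanguage : Language
  StarLanguage = record
    { Sym           = StarSym Sym
    ; arity         = λ { (sym S) → arity S ; R → k ; Int → 1 ; Ext → 1 ; ρ → suc k }
    ; arity-nonZero = λ { (sym S) → arity-nonZero S ; R → >-nonZero (>-nonZero⁻¹ k) ; Int → _ ; Ext → _ ; ρ → _ }
    }

  record Gadget : Set₁ where
    field
      structure : Structure L
    open Structure structure public
    field
      root           : Fin k → Carrier
      root-injective : Injective _≡_ _≡_ root

    IsRoot : Carrier → Set
    IsRoot v = ∃[ i ] root i ≡ v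

    isRoot? : Decidable IsRoot
    isRoot? v = Fin.any? (λ i → Finite._≟_ finite (root i) v)

module Construction {L : Language} {k : ℕ} .{{_ : NonZero k}}
                    (A : Structure (BaseLanguage L k)) (G : Gadget L k) where
  private
    module A = Structure A
    module G = Gadget G

  RTuple : Set
  RTuple = [ e ∈ Vec A.Carrier k ∣ A.rel R e ]

  finiteRTuple : Finite RTuple
  finiteRTuple = finiteRefinement (finiteVec A.finite k) (A.rel? R)

  NonRoot : Set
  NonRoot = [ v ∈ G.Carrier ∣ ¬ G.IsRoot v ]

  finiteNonRoot : Finite NonRoot
  finiteNonRoot = finiteRefinement G.finite (¬? ∘ G.isRoot?)

  -- V(A) ⊔ (Rᴬ × V(G)) and the pairs eᵢ ∼ (e, zᵢ) generating ∼.
  PreVertex : Set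
  PreVertex = A.Carrier ⊎ RTuple × G.Carrier

  data Glue : PreVertex → PreVertex → Set where
    glue : ∀ e i → Glue (inj₁ (lookup (value e) i)) (inj₂ (e , G.root i))

  -- The quotient by ∼, with one normal form per class, together with the class
  -- map; class-surjective and class-kernel show that it is the quotient.
  data Vertex : Set where
    internal : A.Carrier → Vertex
    external : RTuple → NonRoot → Vertex

  class : PreVertex → Vertex
  class (inj₁ a)       = internal a
  class (inj₂ (e , v)) with G.isRoot? v
  ... | yes (i , _) = internal (lookup (value e) i)
  ... | no ¬root    = external e (v ,ʳ [ ¬root ])

  representative : Vertex → PreVertex
  representative (internal a)   = inj₁ a
  representative (external e v) = inj₂ (e , value v)

  class-representative : ∀ x → class (representative x) ≡ x
  class-representative (internal a) = refl
  class-representative (external e (v ,ʳ [ ¬root ])) with G.isRoot? v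
  ... | yes root = contradiction-irr ¬root (λ ¬r → ¬r root)
  ... | no _     = refl

  class-surjective : ∀ x → ∃[ y ] class y ≡ x
  class-surjective x = representative x , class-representative x

  class-kernel : ∀ x y → class x ≡ class y ⇔ EqClosure Glue x y
  class-kernel x y = mk⇔
    (λ eq → EqC.transitive Glue (toRep x)
              (subst (λ c → EqClosure Glue (representative c) y) (≡-sym eq)
                (EqC.symmetric Glue (toRep y))))
    (EqC.gfold isEquivalence class glued)
    where
    toRep : ∀ x → EqClosure Glue x (representative (class x))
    toRep (inj₁ a)       = EqC.reflexive Glue
    toRep (inj₂ (e , v)) with G.isRoot? v
    ... | yes (i , refl) = EqC.symmetric Glue (EqC.return (glue e i))
    ... | no _           = EqC.reflexive Glue

    glued : ∀ {x y} → Glue x y → class x ≡ class y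
    glued (glue e i) with G.isRoot? (G.root i)
    ... | yes (j , eq) = cong (internal ∘ lookup (value e)) (G.root-injective (≡-sym eq))
    ... | no ¬root     = contradiction (i , refl) ¬root

  _≟ⱽ_ : DecidableEquality Vertex
  internal a   ≟ⱽ internal b   = map′ (cong internal) (λ { refl → refl }) (Finite._≟_ A.finite a b)
  internal _   ≟ⱽ external _ _ = no λ ()
  external _ _ ≟ⱽ internal _   = no λ ()
  external e v ≟ⱽ external f w = map′ (λ { (refl , refl) → refl }) (λ { refl → refl , refl })
    (Finite._≟_ finiteRTuple e f ×-dec Finite._≟_ finiteNonRoot v w)

  finiteVertex : Finite Vertex
  finiteVertex = record
    { _≟_      = _≟ⱽ_
    ; elements = List.map internal (elements A.finite) ++ externals
    ; complete = λ
      { (internal a)   → ∈-++⁺ˡ (∈-map⁺ internal (complete A.finite a))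
      ; (external e v) → ∈-++⁺ʳ _ (∈-cartesianProductWith⁺ external
                           (complete finiteRTuple e) (complete finiteNonRoot v))
      }
    ; unique   = Uniq.++⁺
      (Uniq.map⁺ (λ { refl → refl }) (unique A.finite))
      (Uniq.cartesianProductWith⁺ external (λ { refl → refl , refl })
        (unique finiteRTuple) (unique finiteNonRoot))
      disjoint
    }
    where
    open Finite
    externals = cartesianProductWith external (elements finiteRTuple) (elements finiteNonRoot)

    disjoint : ∀ {x} → ¬ (x ∈ List.map internal (elements A.finite) × x ∈ externals)
    disjoint (x∈ , x∈′) with ∈-map⁻ internal x∈ | ∈-cartesianProductWith⁻ external (elements finiteRTuple) (elements finiteNonRoot) x∈′
    ... | _ , _ , refl | _ , _ , _ , _ , ()

  [_]ᵃ : A.Carrier → Vertex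
  [ a ]ᵃ = class (inj₁ a)

  [_,_]ᵍ : RTuple → G.Carrier → Vertex
  [ e , v ]ᵍ = class (inj₂ (e , v))

  Internal : Pred Vertex 0ℓ
  Internal x = ∃[ a ] x ≡ [ a ]ᵃ

  relation : ∀ S → Pred (Vec Vertex (Language.arity (StarLanguage L k) S)) 0ℓ
  relation (sym S) xs       = (∃[ as ] A.rel (sym S) as × xs ≡ Vec.map [_]ᵃ as)
                            ⊎ (∃[ e ] ∃[ vs ] G.rel S vs × xs ≡ Vec.map [ e ,_]ᵍ vs)
  relation R       xs       = ∃[ as ] A.rel R as × xs ≡ Vec.map [_]ᵃ as
  relation Int     (x ∷ []) = Internal x
  relation Ext     (x ∷ []) = ¬ Internal x
  relation ρ       (x ∷ xs) = ∃[ e ] ∃[ v ] ¬ Internal [ e , v ]ᵍ × x ≡ [ e , v ]ᵍ × xs ≡ Vec.map [_]ᵃ (value e)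

  private
    _≟ⱽˢ_ : ∀ {n} → DecidableEquality (Vec Vertex n)
    _≟ⱽˢ_ = Vec.≡-dec _≟ⱽ_

  internal? : Decidable Internal
  internal? x = ∃? A.finite (λ a → x ≟ⱽ [ a ]ᵃ)

  relation? : ∀ S → Decidable (relation S)
  relation? (sym S) xs =
    ∃? (finiteVec A.finite _) (λ as → A.rel? (sym S) as ×-dec (xs ≟ⱽˢ Vec.map [_]ᵃ as)) ⊎-dec
    ∃? finiteRTuple (λ e → ∃? (finiteVec G.finite _) (λ vs → G.rel? S vs ×-dec (xs ≟ⱽˢ Vec.map [ e ,_]ᵍ vs)))
  relation? R   xs       = ∃? (finiteVec A.finite _) (λ as → A.rel? R as ×-dec (xs ≟ⱽˢ Vec.map [_]ᵃ as))
  relation? Int (x ∷ []) = internal? x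
  relation? Ext (x ∷ []) = ¬? (internal? x)
  relation? ρ   (x ∷ xs) =
    ∃? finiteRTuple (λ e → ∃? G.finite (λ v →
      ¬? (internal? [ e , v ]ᵍ) ×-dec (x ≟ⱽ [ e , v ]ᵍ) ×-dec (xs ≟ⱽˢ Vec.map [_]ᵃ (value e))))

  star : Structure (StarLanguage L k)
  star = record
    { Carrier    = Vertex
    ; finite     = finiteVertex
    ; inhabitant = [ A.inhabitant ]ᵃ
    ; rel        = relation
    ; rel?       = relation?
    }

  -- Both vertices are external and ρ takes the same value on them.
  Sameρ : Vertex → Vertex → Set
  Sameρ (external e _) (external f _) = e ≡ f
  Sameρ _              _              = ⊥

  sameρ? : ∀ x y → Dec (Sameρ x y)
  sameρ? (external e _) (external f _) = Finite._≟_ finiteRTuple e f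
  sameρ? (external _ _) (internal _)   = no λ ()
  sameρ? (internal _)   _              = no λ ()

  HasProfile : ∀ {p} → Profile p → Pred (Vec Vertex p) 0ℓ
  HasProfile π a = (∀ i → i ∈ˢ I ⇔ Internal (lookup a i))
                 × (∀ i i′ → SameClass i i′ ⇔ Sameρ (lookup a i) (lookup a i′))
    where open Profile π

  hasProfile? : ∀ {p} (π : Profile p) → Decidable (HasProfile π)
  hasProfile? π a = Fin.all? (λ i → (i ∈ˢ? I) ⇔-dec internal? (lookup a i))
              ×-dec Fin.all? (λ i → Fin.all? (λ i′ → sameClass? i i′ ⇔-dec sameρ? (lookup a i) (lookup a i′)))
    where open Profile π

  profileProbability : ∀ {p} → Profile p → ℚ
  profileProbability {p} π = proportion (hasProfile? π) (tuples finiteVertex p)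

open Construction public using () renaming (star to infixl 7 _⋆_)

RootTupleFree : ∀ {L k} .{{_ : NonZero k}} → Gadget L k → Set
RootTupleFree {L} G = ∀ S vs → Gadget.rel G S vs → ¬ Allᵛ (Gadget.IsRoot G) vs

NonTrivial : ∀ {L k p} .{{_ : NonZero k}} → Profile p →
             (ℕ → Structure (BaseLanguage L k)) → (ℕ → Gadget L k) → Set
NonTrivial π A G = DoesNotTendToZero (λ n → Construction.profileProbability (A n) (G n) π)

-- The total length of p blocks, the i-th consisting of one variable if i ∈ I
-- and of k variables if i ∉ I.
blocksLength : ∀ {p} → ℕ → Subset p → ℕ
blocksLength k []            = 0
blocksLength k (inside ∷ I)  = 1 + blocksLength k I
blocksLength k (outside ∷ I) = k + blocksLength k I

blocksLength-≡ : ∀ {p} k (I : Subset p) → blocksLength k I ≡ ∣ I ∣ + (p ∸ ∣ I ∣) * k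
blocksLength-≡ k []            = refl
blocksLength-≡ k (inside ∷ I)  = cong suc (blocksLength-≡ k I)
blocksLength-≡ {suc p} k (outside ∷ I) = begin
  k + blocksLength k I               ≡⟨ cong (k +_) (blocksLength-≡ k I) ⟩
  k + (∣ I ∣ + (p ∸ ∣ I ∣) * k)      ≡⟨ ℕ.+-assoc k ∣ I ∣ _ ⟨
  k + ∣ I ∣ + (p ∸ ∣ I ∣) * k        ≡⟨ cong (_+ (p ∸ ∣ I ∣) * k) (ℕ.+-comm k ∣ I ∣) ⟩
  ∣ I ∣ + k + (p ∸ ∣ I ∣) * k        ≡⟨ ℕ.+-assoc ∣ I ∣ k _ ⟩
  ∣ I ∣ + (suc (p ∸ ∣ I ∣)) * k      ≡⟨ cong (λ m → ∣ I ∣ + m * k) (ℕ.+-∸-assoc 1 (∣p∣≤n I)) ⟨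
  ∣ I ∣ + (suc p ∸ ∣ I ∣) * k        ∎
  where open ≡-Reasoning

-- The block b_i of the concatenation b₁ … b_p, for i ∉ I.
block : ∀ {X : Set} {k p} (I : Subset p) → Vec X (blocksLength k I) → (i : Fin p) → .(i ∉ˢ I) → Vec X k
block (inside ∷ I)        b       zero    i∉I = contradiction-irr i∉I (λ i∉I → i∉I Vec.here)
block {k = k} (outside ∷ I) b     zero    i∉I = take k b
block (inside ∷ I)        (_ ∷ b) (suc i) i∉I = block I b i (λ i∈I → i∉I (Vec.there i∈I))
block {k = k} (outside ∷ I) b     (suc i) i∉I = block I (drop k b) i (λ i∈I → i∉I (Vec.there i∈I))

module _ {L : Language} {k : ℕ} .{{_ : NonZero k}} {p} (π : Profile p) (A : Structure (BaseLanguage L k)) where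
  open Profile π
  open Structure A

  -- The conditioning event.  A uniformly random b is the concatenation of
  -- independent uniformly random blocks b₁ , … , b_p.
  Conforms : Pred (Vec Carrier (blocksLength k I)) 0ℓ
  Conforms b = (∀ i .(i∉I : i ∉ˢ I) → rel R (block I b i i∉I))
             × (∀ i i′ .(i∉I : i ∉ˢ I) .(i′∉I : i′ ∉ˢ I) → block I b i i∉I ≡ block I b i′ i′∉I ⇔ SameClass i i′)

  private
    given? : ∀ i {P : .(i ∉ˢ I) → Set} → (∀ .(i∉I : i ∉ˢ I) → Dec (P i∉I)) → Dec (∀ .(i∉I : i ∉ˢ I) → P i∉I)
    given? i P? with i ∈ˢ? I
    ... | yes i∈I = yes λ i∉I → contradiction-irr i∉I (λ i∉I → i∉I i∈I)
    ... | no i∉I  = map′ (λ p _ → p) (λ f → f i∉I) (P? i∉I)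

  conforms? : Decidable Conforms
  conforms? b =
    Fin.all? (λ i → given? i (λ i∉I → rel? R (block I b i i∉I))) ×-dec
    Fin.all? (λ i → Fin.all? (λ i′ → given? i (λ i∉I → given? i′ (λ i′∉I →
      Vec.≡-dec (Finite._≟_ finite) (block I b i i∉I) (block I b i′ i′∉I) ⇔-dec sameClass? i i′))))

  -- The conditional probability ⟨φ|_π, A⟩, provided that Conforms is inhabited.
  conditionalProbability : Formula (BaseLanguage L k) (blocksLength k I) → ℚ
  conditionalProbability φ = proportion (sat? A φ) (filter conforms? (tuples finite _))

-- ⟨φ|_π, A_n⟩ is defined for all large n and converges.
ConditionallyConverges : ∀ {L k p} .{{_ : NonZero k}} (π : Profile p) →
  Formula (BaseLanguage L k) (blocksLength k (Profile.I π)) → (ℕ → Structure (BaseLanguage L k)) → Set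
ConditionallyConverges π φ A =
  (∃[ N ] ∀ n → n ≥ N → ∃ (Conforms π (A n))) × Converges (λ n → conditionalProbability π (A n) φ)

{-# OPTIONS --safe #-}
-- Satisfaction of a local φ at b depends only on a ball around b, so A ⋆ G can
-- evaluate φ on the internal vertices a_i and the tuples ρ(a_i) read off from a:
-- no tuple of an L-relation lies in the roots, so the internal vertices induce
-- A.  The resulting formula ψ quantifies only over neighbours of its variables
-- and hence is local, as is the formula expressing the profile π.  A block
-- sequence conforming to π comes from |V(G) ∖ roots|^(p − |I|) tuples of profile
-- π, whence ⟨φ|_π , A⟩ · ⟨π , A ⋆ G⟩ = ⟨π ∧ ψ , A ⋆ G⟩, where both brackets on
-- A ⋆ G converge and the limit of ⟨π , A ⋆ G⟩ is not 0.
module Submission where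

open import Data.Bool.Base using (true; false; if_then_else_)
open import Data.Empty using (⊥; ⊥-elim)
open import Data.Fin.Base using (Fin; zero; suc; _↑ˡ_; _↑ʳ_; fromℕ<)
import Data.Fin.Properties as Fin
open import Data.Fin.Subset using (Subset; inside; outside) renaming (_∈_ to _∈ˢ_; _∉_ to _∉ˢ_)
open import Data.Fin.Subset.Properties using (drop-there) renaming (_∈?_ to _∈ˢ?_)
import Data.Integer.Base as ℤ
import Data.Integer.Properties as ℤ
open import Data.Irrelevant using ([_])
open import Data.List.Base as List using (List; []; _∷_; _++_; length; filter; cartesianProductWith)
open import Data.List.Membership.Propositional using () renaming (_∈_ to _∈ˡ_)
open import Data.List.Membership.Propositional.Properties using (∈-++⁺ˡ; ∈-++⁺ʳ)
import Data.List.Properties as List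
open import Data.List.Relation.Binary.Subset.Propositional using (_⊆_)
import Data.List.Relation.Unary.All as All
import Data.List.Relation.Unary.Any as Anyˡ
import Data.List.Relation.Unary.Any.Properties as Anyˡ
open import Data.Nat.Base using (ℕ; zero; suc; _+_; _*_; _⊔_; _≤_; _<_; _≥_; z≤n; s≤s; NonZero; >-nonZero⁻¹)
import Data.Nat.Properties as ℕ
open import Data.Nat.Solver using () renaming (module +-*-Solver to ℕ-Solver)
open import Data.Product using (∃; ∃-syntax; _×_; _,_; proj₁; proj₂)
open import Data.Product.Function.NonDependent.Propositional using (_×-⇔_)
open import Data.Rational.Base using (ℚ; 0ℚ; 1ℚ; ½; _-_; _/_; ∣_∣; toℚᵘ; positive; nonNegative)
  renaming (_+_ to _+ᵠ_; _*_ to _*ᵠ_; _<_ to _<ᵠ_; _≤_ to _≤ᵠ_)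
import Data.Rational.Properties as ℚ
open import Data.Rational.Solver using () renaming (module +-*-Solver to ℚ-Solver)
import Data.Rational.Unnormalised.Base as ℚᵘ
import Data.Rational.Unnormalised.Properties as ℚᵘ
open import Data.Refinement using (Refinement-syntax; value; value-injective) renaming (_,_ to _,ʳ_)
open import Data.Sum.Base using (_⊎_; inj₁; inj₂)
open import Data.Sum.Function.Propositional using (_⊎-⇔_)
open import Data.Vec.Base as Vec using (Vec; []; _∷_; lookup; tabulate; take; drop; allFin) renaming (_++_ to _++ᵛ_)
open import Data.Vec.Membership.Propositional using () renaming (_∈_ to _∈ᵛ_)
open import Data.Vec.Membership.Propositional.Properties using (∈-lookup; ∈-map⁺)
import Data.Vec.Properties as Vec
import Data.Vec.Relation.Unary.All as Allᵛ
import Data.Vec.Relation.Unary.Any as Anyᵛ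
import Data.Vec.Relation.Unary.Any.Properties as Anyᵛ
open import Function.Base using (_∘_; id)
open import Function.Bundles using (_⇔_; mk⇔; Inverse; Equivalence)
import Function.Properties.Equivalence as ⇔
import Function.Properties.Inverse as Inverse
open import Level using (0ℓ)
open import Relation.Binary.PropositionalEquality
  using (_≡_; refl; cong; cong₂; subst; subst₂; trans; module ≡-Reasoning) renaming (sym to ≡-sym)
import Relation.Binary.Reasoning.Setoid ℚᵘ.≃-setoid as ≃-Reasoning
open import Relation.Nullary using (¬_; Dec; does; yes; no; contradiction; recompute)
open import Relation.Nullary.Decidable using (_×-dec_; _⊎-dec_; dec-false; does-⇔)
open import Relation.Nullary.Negation using (contradiction-irr)
open import Relation.Unary using (Pred; Decidable)
open import Defs

open Equivalence using (to; from)

-- Sequences of rationals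

-- Locality of φ is semantic, an invariance under isomorphisms of neighbourhoods, so a syntactic
-- form has to be produced: the quantifiers of φ are restricted to a ball around its free variables.
-- Adjacency in `A` involves every symbol of `L`, possibly infinitely many, and need not be
-- first-order definable. Hence `A` is first replaced by a structure in which φ keeps its truth
-- value while all adjacencies come from the finitely many symbols of φ; locality is applied to that
-- structure and its ball. A formula over `A ⋆ G` can follow these adjacencies, since a tuple of `A`
-- is recognised there by having internal entries only. Conversely, ψ must be local in the same
-- semantic sense. For this, ψ is written in a syntax whose quantifiers are guarded by relation
-- tuples, so that a radius can be read off. Limits are never divided: a limit exists as soon as the
-- sequence is Cauchy, and the conditional probability is bounded by 1 and solves a linear equation
-- with Cauchy coefficients.

½*-positive : ∀ {ε} → 0ℚ <ᵠ ε → 0ℚ <ᵠ ½ *ᵠ ε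
½*-positive {ε} 0<ε = subst (_<ᵠ ½ *ᵠ ε) (ℚ.*-zeroʳ ½) (ℚ.*-monoʳ-<-pos ½ 0<ε)

½*+½* : ∀ ε → ½ *ᵠ ε +ᵠ ½ *ᵠ ε ≡ ε
½*+½* ε = trans (≡-sym (ℚ.*-distribʳ-+ ε ½ ½)) (ℚ.*-identityˡ ε)

∣-∣-triangle : ∀ x y z → ∣ x - z ∣ ≤ᵠ ∣ x - y ∣ +ᵠ ∣ z - y ∣
∣-∣-triangle x y z = subst (λ w → ∣ w ∣ ≤ᵠ ∣ x - y ∣ +ᵠ ∣ z - y ∣)
  (solve 3 (λ x y z → (x :- y) :- (z :- y) := x :- z) refl x y z)
  (ℚ.∣p-q∣≤∣p∣+∣q∣ (x - y) (z - y))
  where open ℚ-Solver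

converges⇒cauchy : ∀ q → Converges q → Cauchy q
converges⇒cauchy q (x , q⟶x) ε 0<ε with q⟶x (½ *ᵠ ε) (½*-positive 0<ε)
... | N , near = N , close
  where
  close : ∀ m n → m ≥ N → n ≥ N → ∣ q m - q n ∣ <ᵠ ε
  close m n m≥N n≥N with near m m≥N | near n n≥N
  ... | K , nearₘ | K′ , nearₙ = begin-strict
    ∣ q m - q n ∣                 ≤⟨ ∣-∣-triangle (q m) xₖ (q n) ⟩
    ∣ q m - xₖ ∣ +ᵠ ∣ q n - xₖ ∣  <⟨ ℚ.+-mono-< (nearₘ k (ℕ.m≤m⊔n K K′)) (nearₙ k (ℕ.m≤n⊔m K K′)) ⟩
    ½ *ᵠ ε +ᵠ ½ *ᵠ ε              ≡⟨ ½*+½* ε ⟩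
    ε                             ∎
    where
    open ℚ.≤-Reasoning
    k  = K ⊔ K′
    xₖ = ℝ.approx x k

-- A real is a Cauchy sequence of rationals, so the sequence itself serves as its limit.
cauchy⇒converges : ∀ q → Cauchy q → Converges q
cauchy⇒converges q cauchy = record { approx = q ; cauchy = cauchy } , λ ε 0<ε →
  let N , close = cauchy ε 0<ε in N , λ n n≥N → N , λ k k≥N → close n k n≥N k≥N

-- Non-triviality yields only infinitely many large terms. A single one beyond `N` suffices: all
-- terms from `N` on stay within `½ *ᵠ ε` of it, and so exceed `½ *ᵠ ε` in absolute value.
boundedAwayFromZero : ∀ s → Cauchy s → DoesNotTendToZero s →
  ∃[ δ ] 0ℚ <ᵠ δ × ∃[ N ] ∀ n → n ≥ N → δ <ᵠ ∣ s n ∣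
boundedAwayFromZero s cauchy (ε , 0<ε , large) with cauchy (½ *ᵠ ε) (½*-positive 0<ε)
... | N , close with large N
... | m , m≥N , ε≤∣sₘ∣ = ½ *ᵠ ε , ½*-positive 0<ε , N , λ n n≥N → ℚ.≰⇒> λ ∣sₙ∣≤½ε →
  ℚ.<-irrefl refl (begin-strict
    ε                         ≤⟨ ε≤∣sₘ∣ ⟩
    ∣ s m ∣                   ≡⟨ cong ∣_∣ (solve 2 (λ x y → x := (x :- y) :+ y) refl (s m) (s n)) ⟩
    ∣ s m - s n +ᵠ s n ∣      ≤⟨ ℚ.∣p+q∣≤∣p∣+∣q∣ (s m - s n) (s n) ⟩
    ∣ s m - s n ∣ +ᵠ ∣ s n ∣  <⟨ ℚ.+-mono-<-≤ (close m n m≥N n≥N) ∣sₙ∣≤½ε ⟩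
    ½ *ᵠ ε +ᵠ ½ *ᵠ ε          ≡⟨ ½*+½* ε ⟩
    ε                         ∎)
  where
  open ℚ.≤-Reasoning
  open ℚ-Solver

-- Division is avoided by `s m (c m - c n) = (q m - q n) + c n (s n - s
-- m)`. With `c` bounded by 1 the right side is below `δ *ᵠ ε`, one half from each sequence, and `δ
-- <ᵠ ∣ s m ∣` then permits cancelling `∣ s m ∣`.
quotient-cauchy : ∀ (c s q : ℕ → ℚ) → (∀ n → c n *ᵠ s n ≡ q n) → (∀ n → ∣ c n ∣ ≤ᵠ 1ℚ) →
  Cauchy s → Cauchy q → ∀ {δ N} → 0ℚ <ᵠ δ → (∀ n → n ≥ N → δ <ᵠ ∣ s n ∣) → Cauchy c
quotient-cauchy c s q cs≡q ∣c∣≤1 s-cauchy q-cauchy {δ} {N} 0<δ δ<∣s∣ ε 0<ε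
  with s-cauchy (½ *ᵠ (δ *ᵠ ε)) 0<½δε | q-cauchy (½ *ᵠ (δ *ᵠ ε)) 0<½δε
  where
  instance _ = positive 0<δ
  0<½δε = ½*-positive (subst (_<ᵠ δ *ᵠ ε) (ℚ.*-zeroʳ δ) (ℚ.*-monoʳ-<-pos δ 0<ε))
... | Nₛ , s-close | N_q , q-close = N ⊔ (Nₛ ⊔ N_q) , close
  where
  open ℚ.≤-Reasoning
  open ℚ-Solver using (solve; _:=_; _:+_; _:*_; _:-_)
  close : ∀ m n → m ≥ N ⊔ (Nₛ ⊔ N_q) → n ≥ N ⊔ (Nₛ ⊔ N_q) → ∣ c m - c n ∣ <ᵠ ε
  close m n m≥ n≥ = ℚ.*-cancelˡ-<-nonNeg ∣ s m ∣ (begin-strict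
    ∣ s m ∣ *ᵠ ∣ c m - c n ∣                           ≡⟨ ℚ.∣p*q∣≡∣p∣*∣q∣ (s m) (c m - c n) ⟨
    ∣ s m *ᵠ (c m - c n) ∣                             ≡⟨ cong ∣_∣ (solve 4 (λ s s′ c c′ →
                                                          s :* (c :- c′) := (c :* s :- c′ :* s′) :+ c′ :* (s′ :- s))
                                                          refl (s m) (s n) (c m) (c n)) ⟩
    ∣ c m *ᵠ s m - c n *ᵠ s n +ᵠ c n *ᵠ (s n - s m) ∣  ≡⟨ cong₂ (λ x y → ∣ x - y +ᵠ c n *ᵠ (s n - s m) ∣) (cs≡q m) (cs≡q n) ⟩
    ∣ q m - q n +ᵠ c n *ᵠ (s n - s m) ∣                ≤⟨ ℚ.∣p+q∣≤∣p∣+∣q∣ (q m - q n) (c n *ᵠ (s n - s m)) ⟩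
    ∣ q m - q n ∣ +ᵠ ∣ c n *ᵠ (s n - s m) ∣            ≡⟨ cong (∣ q m - q n ∣ +ᵠ_) (ℚ.∣p*q∣≡∣p∣*∣q∣ (c n) (s n - s m)) ⟩
    ∣ q m - q n ∣ +ᵠ ∣ c n ∣ *ᵠ ∣ s n - s m ∣          ≤⟨ ℚ.+-monoʳ-≤ ∣ q m - q n ∣ (ℚ.*-monoʳ-≤-nonNeg ∣ s n - s m ∣ (∣c∣≤1 n)) ⟩
    ∣ q m - q n ∣ +ᵠ 1ℚ *ᵠ ∣ s n - s m ∣               ≡⟨ cong (∣ q m - q n ∣ +ᵠ_) (ℚ.*-identityˡ ∣ s n - s m ∣) ⟩
    ∣ q m - q n ∣ +ᵠ ∣ s n - s m ∣                     <⟨ ℚ.+-mono-< (q-close m n (N_q≤ m≥) (N_q≤ n≥)) (s-close n m (Nₛ≤ n≥) (Nₛ≤ m≥)) ⟩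
    ½ *ᵠ (δ *ᵠ ε) +ᵠ ½ *ᵠ (δ *ᵠ ε)                     ≡⟨ ½*+½* (δ *ᵠ ε) ⟩
    δ *ᵠ ε                                             ≤⟨ ℚ.*-monoʳ-≤-nonNeg ε (ℚ.<⇒≤ (δ<∣s∣ m (ℕ.m⊔n≤o⇒m≤o N _ m≥))) ⟩
    ∣ s m ∣ *ᵠ ε                                       ∎)
    where
    instance
      _ = nonNegative (ℚ.0≤∣p∣ (s m))
      _ = nonNegative (ℚ.0≤∣p∣ (s n - s m))
      _ = nonNegative (ℚ.<⇒≤ 0<ε)
    Nₛ≤ : ∀ {m} → m ≥ N ⊔ (Nₛ ⊔ N_q) → m ≥ Nₛ
    Nₛ≤ = ℕ.m⊔n≤o⇒m≤o Nₛ N_q ∘ ℕ.m⊔n≤o⇒n≤o N (Nₛ ⊔ N_q)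
    N_q≤ : ∀ {m} → m ≥ N ⊔ (Nₛ ⊔ N_q) → m ≥ N_q
    N_q≤ = ℕ.m⊔n≤o⇒n≤o Nₛ N_q ∘ ℕ.m⊔n≤o⇒n≤o N (Nₛ ⊔ N_q)

-- Finite sums and proportions

∑ : {X : Set} → List X → (X → ℕ) → ℕ
∑ []       f = 0
∑ (x ∷ xs) f = f x + ∑ xs f

module _ {X : Set} where

  ∑-cong : ∀ {f g : X → ℕ} → (∀ x → f x ≡ g x) → ∀ xs → ∑ xs f ≡ ∑ xs g
  ∑-cong f≡g []       = refl
  ∑-cong f≡g (x ∷ xs) = cong₂ _+_ (f≡g x) (∑-cong f≡g xs)

  ∑-zero : ∀ {f : X → ℕ} → (∀ x → f x ≡ 0) → ∀ xs → ∑ xs f ≡ 0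
  ∑-zero f≡0 []       = refl
  ∑-zero f≡0 (x ∷ xs) = cong₂ _+_ (f≡0 x) (∑-zero f≡0 xs)

  ∑-++ : ∀ (f : X → ℕ) xs ys → ∑ (xs ++ ys) f ≡ ∑ xs f + ∑ ys f
  ∑-++ f []       ys = refl
  ∑-++ f (x ∷ xs) ys = trans (cong (f x +_) (∑-++ f xs ys)) (≡-sym (ℕ.+-assoc (f x) (∑ xs f) (∑ ys f)))

  ∑-* : ∀ w (f : X → ℕ) xs → ∑ xs (λ x → w * f x) ≡ w * ∑ xs f
  ∑-* w f []       = ≡-sym (ℕ.*-zeroʳ w)
  ∑-* w f (x ∷ xs) = trans (cong (w * f x +_) (∑-* w f xs)) (≡-sym (ℕ.*-distribˡ-+ w (f x) (∑ xs f)))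

  ∑-const : ∀ n (xs : List X) → ∑ xs (λ _ → n) ≡ length xs * n
  ∑-const n []       = refl
  ∑-const n (_ ∷ xs) = cong (n +_) (∑-const n xs)

∑-map : ∀ {X Y : Set} (g : X → Y) (f : Y → ℕ) xs → ∑ (List.map g xs) f ≡ ∑ xs (f ∘ g)
∑-map g f []       = refl
∑-map g f (x ∷ xs) = cong (f (g x) +_) (∑-map g f xs)

∑-cartesianProductWith : ∀ {X Y Z : Set} (g : X → Y → Z) (f : Z → ℕ) xs ys →
  ∑ (cartesianProductWith g xs ys) f ≡ ∑ xs (λ x → ∑ ys (f ∘ g x))
∑-cartesianProductWith g f []       ys = refl
∑-cartesianProductWith g f (x ∷ xs) ys =
  trans (∑-++ f (List.map (g x) ys) _) (cong₂ _+_ (∑-map (g x) f ys) (∑-cartesianProductWith g f xs ys))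

module _ {X : Set} (fin : Finite X) where

  ∑-tuples-++ : ∀ k {m} (f : Vec X (k + m) → ℕ) →
    ∑ (tuples fin (k + m)) f ≡ ∑ (tuples fin k) (λ u → ∑ (tuples fin m) (λ v → f (u ++ᵛ v)))
  ∑-tuples-++ zero    f = ≡-sym (ℕ.+-identityʳ _)
  ∑-tuples-++ (suc k) f = begin
    ∑ (tuples fin (suc k + _)) f
      ≡⟨ ∑-cartesianProductWith _∷_ f elements (tuples fin (k + _)) ⟩
    ∑ elements (λ x → ∑ (tuples fin (k + _)) (f ∘ (x ∷_)))
      ≡⟨ ∑-cong (λ x → ∑-tuples-++ k (f ∘ (x ∷_))) elements ⟩
    ∑ elements (λ x → ∑ (tuples fin k) (λ u → ∑ (tuples fin _) (λ v → f (x ∷ u ++ᵛ v))))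
      ≡⟨ ∑-cartesianProductWith _∷_ (λ u → ∑ (tuples fin _) (λ v → f (u ++ᵛ v))) elements (tuples fin k) ⟨
    ∑ (tuples fin (suc k)) (λ u → ∑ (tuples fin _) (λ v → f (u ++ᵛ v))) ∎
    where
    open ≡-Reasoning
    open Finite fin

  ∑-refineList : ∀ {P : Pred X 0ℓ} (P? : Decidable P) (f : X → ℕ) → (∀ x → ¬ P x → f x ≡ 0) →
    ∀ xs → ∑ (refineList fin P? xs) (f ∘ value) ≡ ∑ xs f
  ∑-refineList P? f f≡0 []       = refl
  ∑-refineList P? f f≡0 (x ∷ xs) with P? x
  ... | yes _  = cong (f x +_) (∑-refineList P? f f≡0 xs)
  ... | no ¬px = trans (∑-refineList P? f f≡0 xs) (cong (_+ ∑ xs f) (≡-sym (f≡0 x ¬px)))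

𝟙 : ∀ {P : Set} → Dec P → ℕ
𝟙 P? = if does P? then 1 else 0

𝟙-cong : ∀ {P Q : Set} → P ⇔ Q → (P? : Dec P) (Q? : Dec Q) → 𝟙 P? ≡ 𝟙 Q?
𝟙-cong P⇔Q P? Q? = cong (if_then 1 else 0) (does-⇔ P⇔Q P? Q?)

𝟙-no : ∀ {P : Set} (P? : Dec P) → ¬ P → 𝟙 P? ≡ 0
𝟙-no P? ¬p = cong (if_then 1 else 0) (dec-false P? ¬p)

module _ {X : Set} {P : Pred X 0ℓ} (P? : Decidable P) where

  length-filter-∑ : ∀ xs → length (filter P? xs) ≡ ∑ xs (𝟙 ∘ P?)
  length-filter-∑ []       = refl
  length-filter-∑ (x ∷ xs) with does (P? x)
  ... | true  = cong suc (length-filter-∑ xs)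
  ... | false = length-filter-∑ xs

  length-filter-filter-∑ : ∀ {Q : Pred X 0ℓ} (Q? : Decidable Q) xs →
    length (filter Q? (filter P? xs)) ≡ ∑ xs (λ x → 𝟙 (P? x ×-dec Q? x))
  length-filter-filter-∑ Q? []       = refl
  length-filter-filter-∑ Q? (x ∷ xs) with does (P? x)
  ... | false = length-filter-filter-∑ Q? xs
  ... | true with does (Q? x)
  ...   | true  = cong suc (length-filter-filter-∑ Q? xs)
  ...   | false = length-filter-filter-∑ Q? xs

  proportion-cong : ∀ {Q : Pred X 0ℓ} (Q? : Decidable Q) → (∀ x → P x ⇔ Q x) →
    ∀ xs → proportion P? xs ≡ proportion Q? xs
  proportion-cong Q? P⇔Q []          = refl
  proportion-cong Q? P⇔Q xs@(_ ∷ _) =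
    cong (λ ys → ℤ.+ length ys / length xs)
      (List.filter-≐ P? Q? ((λ {x} → to (P⇔Q x)) , (λ {x} → from (P⇔Q x))) xs)

  ∣proportion∣≤1 : ∀ xs → ∣ proportion P? xs ∣ ≤ᵠ 1ℚ
  ∣proportion∣≤1 []          = ℚ.<⇒≤ (ℚ.positive⁻¹ 1ℚ)
  ∣proportion∣≤1 xs@(_ ∷ _) = begin
    ∣ ℤ.+ m / n ∣  ≡⟨ ℚ.0≤p⇒∣p∣≡p (ℚ.nonNegative⁻¹ (ℤ.+ m / n) {{ℚ.normalize-nonNeg m n}}) ⟩
    ℤ.+ m / n      ≤⟨ ℚ.toℚᵘ-cancel-≤ (ℚᵘ.≤-respˡ-≃ (ℚᵘ.≃-sym (ℚ.toℚᵘ-fromℚᵘ (ℤ.+ m ℚᵘ./ n))) (ℚᵘ.*≤* cross)) ⟩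
    1ℚ             ∎
    where
    open ℚ.≤-Reasoning
    m = length (filter P? xs)
    n = length xs
    cross : ℤ.+ m ℤ.* ℤ.1ℤ ℤ.≤ ℤ.1ℤ ℤ.* ℤ.+ n
    cross rewrite ℤ.*-identityʳ (ℤ.+ m) | ℤ.*-identityˡ (ℤ.+ n) = ℤ.+≤+ (List.length-filter P? xs)

proportion-zero : ∀ {X : Set} {P : Pred X 0ℓ} (P? : Decidable P) → (∀ x → ¬ P x) → ∀ xs → proportion P? xs ≡ 0ℚ
proportion-zero P? ¬p []          = refl
proportion-zero P? ¬p xs@(_ ∷ _) = trans
  (cong (λ ys → ℤ.+ length ys / length xs) (List.filter-none P? (All.universal ¬p xs)))
  (ℚ.0/n≡0 (length xs))

-- The factor `length ys` cancels. If `ys` is empty, the left side vanishes through the dummy value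
-- of `proportion`, and the right side because `Q≡` makes its numerator 0.
proportion-scaled : ∀ {X Y : Set} {P Q : Pred X 0ℓ} {D : Pred Y 0ℓ}
  (P? : Decidable P) (Q? : Decidable Q) (D? : Decidable D) w xs ys →
  length (filter P? xs) ≡ w * length ys →
  length (filter Q? xs) ≡ w * length (filter D? ys) →
  proportion D? ys *ᵠ proportion P? xs ≡ proportion Q? xs
proportion-scaled P? Q? D? w []          ys          P≡ Q≡ = ℚ.*-zeroʳ (proportion D? ys)
proportion-scaled P? Q? D? w xs@(_ ∷ _) []          P≡ Q≡ rewrite Q≡ | ℕ.*-zeroʳ w =
  trans (ℚ.*-zeroˡ (proportion P? xs)) (≡-sym (ℚ.0/n≡0 (length xs)))
proportion-scaled P? Q? D? w xs@(_ ∷ _) ys@(_ ∷ _) P≡ Q≡ rewrite P≡ | Q≡ = ℚ.toℚᵘ-injective (begin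
  toℚᵘ ((ℤ.+ d / c) *ᵠ (ℤ.+ (w * c) / t))
    ≈⟨ ℚ.toℚᵘ-homo-* (ℤ.+ d / c) (ℤ.+ (w * c) / t) ⟩
  toℚᵘ (ℤ.+ d / c) ℚᵘ.* toℚᵘ (ℤ.+ (w * c) / t)
    ≈⟨ ℚᵘ.*-cong (ℚ.toℚᵘ-fromℚᵘ (ℤ.+ d ℚᵘ./ c)) (ℚ.toℚᵘ-fromℚᵘ (ℤ.+ (w * c) ℚᵘ./ t)) ⟩
  (ℤ.+ d ℚᵘ./ c) ℚᵘ.* (ℤ.+ (w * c) ℚᵘ./ t)
    ≈⟨ ℚᵘ.*≡* cross ⟩
  ℤ.+ (w * d) ℚᵘ./ t
    ≈⟨ ℚ.toℚᵘ-fromℚᵘ (ℤ.+ (w * d) ℚᵘ./ t) ⟨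
  toℚᵘ (ℤ.+ (w * d) / t) ∎)
  where
  open ≃-Reasoning
  open ℕ-Solver
  d = length (filter D? ys)
  c = length ys
  t = length xs
  cross : ℤ.+ d ℤ.* ℤ.+ (w * c) ℤ.* ℤ.+ t ≡ ℤ.+ (w * d) ℤ.* (ℤ.+ c ℤ.* ℤ.+ t)
  cross rewrite ≡-sym (ℤ.pos-* d (w * c)) | ≡-sym (ℤ.pos-* (d * (w * c)) t) | ≡-sym (ℤ.pos-* c t) | ≡-sym (ℤ.pos-* (w * d) (c * t)) =
    cong ℤ.+_ (solve 4 (λ d w c t → d :* (w :* c) :* t := w :* d :* (c :* t)) refl d w c t)

-- Concatenation and mapping of vectors

take-++ : ∀ {X : Set} {m n} (xs : Vec X m) (ys : Vec X n) → take m (xs ++ᵛ ys) ≡ xs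
take-++ {m = m} xs ys = Vec.++-injectiveˡ _ xs (Vec.take++drop≡id m (xs ++ᵛ ys))

drop-++ : ∀ {X : Set} {m n} (xs : Vec X m) (ys : Vec X n) → drop m (xs ++ᵛ ys) ≡ ys
drop-++ {m = m} xs ys = Vec.++-injectiveʳ _ xs (Vec.take++drop≡id m (xs ++ᵛ ys))

lookup-++-all : ∀ {X Y : Set} (P : X → Y → Set) {m n} {t : Vec X m} {t′ : Vec Y m} {a : Vec X n} {a′ : Vec Y n} →
  (∀ i → P (lookup t i) (lookup t′ i)) → (∀ i → P (lookup a i) (lookup a′ i)) →
  ∀ i → P (lookup (t ++ᵛ a) i) (lookup (t′ ++ᵛ a′) i)
lookup-++-all P {t = []}    {[]}    pt pa i       = pa i
lookup-++-all P {t = _ ∷ _} {_ ∷ _} pt pa zero    = pt zero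
lookup-++-all P {t = _ ∷ t} {_ ∷ t′} {a} {a′} pt pa (suc i) = lookup-++-all P {t = t} {t′} {a} {a′} (pt ∘ suc) pa i

lookup-map-all : ∀ {X Y Z : Set} (P : X → Y → Set) {m} {f : Z → X} {g : Z → Y} →
  (∀ z → P (f z) (g z)) → (zs : Vec Z m) → ∀ i → P (lookup (Vec.map f zs) i) (lookup (Vec.map g zs) i)
lookup-map-all P p (z ∷ zs) zero    = p z
lookup-map-all P p (z ∷ zs) (suc i) = lookup-map-all P p zs i

-- Guarded formulas

-- near S i x φ says that some tuple of S with i-th entry x satisfies φ, its
-- entries being the first variables of φ.
data Guarded (L : Language) (n : ℕ) : Set where
  falsum     : Guarded L n
  equal      : Fin n → Fin n → Guarded L n
  atom       : (S : Language.Sym L) → Vec (Fin n) (Language.arity L S) → Guarded L n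
  not        : Guarded L n → Guarded L n
  _and_ _or_ : Guarded L n → Guarded L n → Guarded L n
  near       : (S : Language.Sym L) → Fin (Language.arity L S) → Fin n → Guarded L (Language.arity L S + n) → Guarded L n

module _ {L : Language} where
  open Language L

  -- Every entry of the tuple introduced by `near` is within distance 1 of a variable already
  -- present, so the nesting depth of `near` bounds how far the formula sees.
  radius : ∀ {n} → Guarded L n → ℕ
  radius falsum         = 0
  radius (equal x y)    = 0
  radius (atom S xs)    = 0
  radius (not φ)        = radius φ
  radius (φ and ψ)      = radius φ ⊔ radius ψ
  radius (φ or ψ)       = radius φ ⊔ radius ψ
  radius (near S i x φ) = suc (radius φ)

  ∃ⁿ : ∀ m {n} → Formula L (m + n) → Formula L n
  ∃ⁿ zero    φ = φ
  ∃ⁿ (suc m) φ = ∃ⁿ m (∃′ φ)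

  formula : ∀ {n} → Guarded L n → Formula L n
  -- Without free variables there are no atomic formulas, all arities being positive; falsity
  -- therefore needs a quantifier.
  formula falsum         = ∃′ (¬′ (zero ≐ zero))
  formula (equal x y)    = x ≐ y
  formula (atom S xs)    = S ⦅ xs ⦆
  formula (not φ)        = ¬′ formula φ
  formula (φ and ψ)      = formula φ ∧′ formula ψ
  formula (φ or ψ)       = ¬′ ((¬′ formula φ) ∧′ (¬′ formula ψ))
  formula (near S i x φ) = ∃ⁿ (arity S)
    ((S ⦅ tabulate (_↑ˡ _) ⦆) ∧′ (((i ↑ˡ _) ≐ (arity S ↑ʳ x)) ∧′ formula φ))

  any all : ∀ {m n} → (Fin m → Guarded L n) → Guarded L n
  any {zero}  φ = falsum
  any {suc m} φ = φ zero or any (φ ∘ suc)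
  all {zero}  φ = not falsum
  all {suc m} φ = φ zero and all (φ ∘ suc)

  module _ (A : Structure L) where
    open Structure A

    infix 4 _⊩_[_]

    _⊩_[_] : ∀ {n} → Guarded L n → Vec Carrier n → Set
    _⊩_[_] falsum         a = ⊥
    _⊩_[_] (equal x y)    a = lookup a x ≡ lookup a y
    _⊩_[_] (atom S xs)    a = rel S (Vec.map (lookup a) xs)
    _⊩_[_] (not φ)        a = ¬ _⊩_[_] φ a
    _⊩_[_] (φ and ψ)      a = _⊩_[_] φ a × _⊩_[_] ψ a
    _⊩_[_] (φ or ψ)       a = _⊩_[_] φ a ⊎ _⊩_[_] ψ a
    _⊩_[_] (near S i x φ) a = ∃[ t ] rel S t × lookup t i ≡ lookup a x × _⊩_[_] φ (t ++ᵛ a)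

    ⊩-any : ∀ {m n} (φ : Fin m → Guarded L n) {a} → _⊩_[_] (any φ) a ⇔ (∃[ i ] _⊩_[_] (φ i) a)
    ⊩-any {zero}  φ = mk⇔ (λ ()) (λ ())
    ⊩-any {suc m} φ = mk⇔
      (λ { (inj₁ h) → zero , h ; (inj₂ h) → let i , h′ = to (⊩-any (φ ∘ suc)) h in suc i , h′ })
      (λ { (zero , h) → inj₁ h ; (suc i , h) → inj₂ (from (⊩-any (φ ∘ suc)) (i , h)) })

    ⊩-all : ∀ {m n} (φ : Fin m → Guarded L n) {a} → _⊩_[_] (all φ) a ⇔ (∀ i → _⊩_[_] (φ i) a)
    ⊩-all {zero}  φ = mk⇔ (λ _ ()) (λ _ → id)
    ⊩-all {suc m} φ = mk⇔
      (λ { (h , hs) zero → h ; (h , hs) (suc i) → to (⊩-all (φ ∘ suc)) hs i })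
      (λ h → h zero , from (⊩-all (φ ∘ suc)) (h ∘ suc))

    ⊨-∃ⁿ : ∀ m {n} (φ : Formula L (m + n)) {a} → A ⊨ ∃ⁿ m φ [ a ] ⇔ (∃[ t ] A ⊨ φ [ t ++ᵛ a ])
    ⊨-∃ⁿ zero    φ = mk⇔ ([] ,_) (λ { ([] , h) → h })
    ⊨-∃ⁿ (suc m) φ = ⇔.trans (⊨-∃ⁿ m (∃′ φ))
      (mk⇔ (λ { (t , v , h) → v ∷ t , h }) (λ { (v ∷ t , h) → t , v , h }))

    map-lookup-↑ˡ : ∀ {m n} (t : Vec Carrier m) (a : Vec Carrier n) →
      Vec.map (lookup (t ++ᵛ a)) (tabulate (_↑ˡ n)) ≡ t
    map-lookup-↑ˡ t a = begin
      Vec.map (lookup (t ++ᵛ a)) (tabulate (_↑ˡ _))  ≡⟨ Vec.tabulate-∘ (lookup (t ++ᵛ a)) (_↑ˡ _) ⟨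
      tabulate (lookup (t ++ᵛ a) ∘ (_↑ˡ _))          ≡⟨ Vec.tabulate-cong (Vec.lookup-++ˡ t a) ⟩
      tabulate (lookup t)                            ≡⟨ Vec.tabulate∘lookup t ⟩
      t                                              ∎
      where open ≡-Reasoning

    ⊨-formula : ∀ {n} (φ : Guarded L n) {a} → A ⊨ formula φ [ a ] ⇔ _⊩_[_] φ a
    ⊨-formula falsum         = mk⇔ (λ (_ , h) → h refl) ⊥-elim
    ⊨-formula (equal x y)    = ⇔.refl
    ⊨-formula (atom S xs)    = ⇔.refl
    ⊨-formula (not φ)        = mk⇔ (_∘ from (⊨-formula φ)) (_∘ to (⊨-formula φ))
    ⊨-formula (φ and ψ)      = ⊨-formula φ ×-⇔ ⊨-formula ψ
    ⊨-formula (φ or ψ) {a}   = ⇔.trans deMorgan (⊨-formula φ ⊎-⇔ ⊨-formula ψ)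
      where
      deMorgan : A ⊨ formula (φ or ψ) [ a ] ⇔ (A ⊨ formula φ [ a ] ⊎ A ⊨ formula ψ [ a ])
      deMorgan with sat? A (formula φ) a | sat? A (formula ψ) a
      ... | yes h | _      = mk⇔ (λ _ → inj₁ h) (λ _ (¬h , _) → ¬h h)
      ... | no _  | yes h  = mk⇔ (λ _ → inj₂ h) (λ _ (_ , ¬h) → ¬h h)
      ... | no ¬h | no ¬h′ = mk⇔ (λ k → ⊥-elim (k (¬h , ¬h′)))
                                 (λ { (inj₁ h) → ⊥-elim (¬h h) ; (inj₂ h) → ⊥-elim (¬h′ h) })
    ⊨-formula (near S i x φ) {a} = ⇔.trans (⊨-∃ⁿ (arity S) _) (mk⇔
      (λ (t , s , e , h) → t , subst (rel S) (map-lookup-↑ˡ t a) s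
        , trans (≡-sym (Vec.lookup-++ˡ t a i)) (trans e (Vec.lookup-++ʳ t a x)) , to (⊨-formula φ) h)
      (λ (t , s , e , h) → t , subst (rel S) (≡-sym (map-lookup-↑ˡ t a)) s
        , trans (Vec.lookup-++ˡ t a i) (trans e (≡-sym (Vec.lookup-++ʳ t a x))) , from (⊨-formula φ) h))

  -- Invariance of guarded formulas under isomorphisms of neighbourhoods

  neighbourhood-mono : ∀ {A : Structure L} {n a r s v} → r ≤ s → Neighbourhood A {n} a r v → Neighbourhood A a s v
  neighbourhood-mono r≤s       (centre i)  = centre i
  neighbourhood-mono (s≤s r≤s) (step nb e) = step (neighbourhood-mono r≤s nb) e

  neighbourhood-tuple : ∀ {A : Structure L} {n a r u} → let open Structure A in
    Neighbourhood A {n} a r u → ∀ {S t} i → rel S t → lookup t i ≡ u → ∀ j → Neighbourhood A a (suc r) (lookup t j)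
  -- Adjacent vertices are distinct, so an entry equal to the given one is reached without a step.
  neighbourhood-tuple {A} nb {S} {t} i s refl j with Finite._≟_ (Structure.finite A) (lookup t i) (lookup t j)
  ... | yes e = subst (Neighbourhood A _ _) e (neighbourhood-mono (ℕ.n≤1+n _) nb)
  ... | no ≢  = step nb (≢ , S , t , s , ∈-lookup i t , ∈-lookup j t)

  -- Truth is transferred in one direction at a time; under a negation it has to travel along the
  -- inverse isomorphism.
  NeighbourhoodIso-sym : ∀ {A B : Structure L} {n r a b} → NeighbourhoodIso A B {n} r a b → NeighbourhoodIso B A r b a
  NeighbourhoodIso-sym {A} {B} {a = a} {b} f = record
    { iso       = Inverse.sym iso
    ; preserves = λ S t → ⇔.sym (subst₂ (λ x y → A.rel S x ⇔ B.rel S y)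
        (≡-sym (Vec.map-∘ proj₁ (Inverse.from iso) t))
        (trans (≡-sym (Vec.map-∘ (proj₁ ∘ to′) (Inverse.from iso) t))
          (Vec.map-cong (λ x → Inverse.strictlyInverseˡ iso x) t))
        (preserves S (Vec.map (Inverse.from iso) t)))
    ; centres   = λ i → Inverse.inverseʳ iso (≡-sym (centres i))
    }
    where
    open NeighbourhoodIso f renaming (to to to′)
    module A = Structure A
    module B = Structure B

  module Transfer {A B : Structure L} {n r a b} (f : NeighbourhoodIso A B {n} r a b) where
    open NeighbourhoodIso f renaming (to to to′)
    private
      module A = Structure A
      module B = Structure B

    -- Two radii are at play: `r` is the domain of the isomorphism, `s` the depth reached so far.
    -- The distance is recorded on both sides so that the link can be reversed.
    record Linked (s : ℕ) (u : A.Carrier) (v : B.Carrier) : Set where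
      constructor linked
      field
        near-a : Neighbourhood A a s u
        near-b : Neighbourhood B b s v
        within : Neighbourhood A a r u
        image  : proj₁ (to′ (u , within)) ≡ v

    linked-≡ : ∀ {s u u′ v v′} → Linked s u v → Linked s u′ v′ → u ≡ u′ ⇔ v ≡ v′
    linked-≡ (linked _ _ nb refl) (linked _ _ nb′ refl) =
      mk⇔ (Inverse.to-cong iso) (λ e → trans (≡-sym (Inverse.strictlyInverseʳ iso (_ , nb))) (Inverse.inverseʳ iso e))

    linked-suc : ∀ {s u v} → Linked s u v → Linked (suc s) u v
    linked-suc (linked p q nb e) = linked (neighbourhood-mono (ℕ.n≤1+n _) p) (neighbourhood-mono (ℕ.n≤1+n _) q) nb e

    linked-rel : ∀ {s S t t′} → (∀ i → Linked s (lookup t i) (lookup t′ i)) → A.rel S t ⇔ B.rel S t′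
    linked-rel {S = S} {t} {t′} ls = subst₂ (λ x y → A.rel S x ⇔ B.rel S y)
      (trans (≡-sym (Vec.tabulate-∘ proj₁ g)) (Vec.tabulate∘lookup t))
      (trans (≡-sym (Vec.tabulate-∘ (proj₁ ∘ to′) g))
        (trans (Vec.tabulate-cong (λ i → Linked.image (ls i))) (Vec.tabulate∘lookup t′)))
      (preserves S (tabulate g))
      where
      g : ∀ i → ∃ (Neighbourhood A a r)
      g i = lookup t i , Linked.within (ls i)

    -- As `s < r`, the whole tuple lies in the domain of the isomorphism and can be mapped. Its
    -- image contains `v`, which keeps all image entries within `suc s` of `b`.
    linked-tuple : ∀ {s u v S t i} → s < r → Linked s u v → A.rel S t → lookup t i ≡ u →
      ∃[ t′ ] B.rel S t′ × lookup t′ i ≡ v × ∀ j → Linked (suc s) (lookup t j) (lookup t′ j)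
    linked-tuple {s} {u} {v} {S} {t} {i} s<r (linked p q nb refl) st refl =
      t′ , st′ , t′ᵢ≡v , λ j → linked (nb-t j) (neighbourhood-tuple q i st′ t′ᵢ≡v j) (nb-r j) (≡-sym (lookup-t′ j))
      where
      nb-t : ∀ j → Neighbourhood A a (suc s) (lookup t j)
      nb-t = neighbourhood-tuple p i st refl
      nb-r : ∀ j → Neighbourhood A a r (lookup t j)
      nb-r j = neighbourhood-mono s<r (nb-t j)
      g : ∀ j → ∃ (Neighbourhood A a r)
      g j = lookup t j , nb-r j
      t′ = Vec.map (proj₁ ∘ to′) (tabulate g)
      lookup-t′ : ∀ j → lookup t′ j ≡ proj₁ (to′ (g j))
      lookup-t′ j = trans (Vec.lookup-map j (proj₁ ∘ to′) (tabulate g)) (cong (proj₁ ∘ to′) (Vec.lookup∘tabulate g j))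
      t′ᵢ≡v = trans (lookup-t′ i) (Inverse.to-cong iso refl)
      st′ : B.rel S t′
      st′ = to (preserves S (tabulate g))
        (subst (A.rel S) (≡-sym (trans (≡-sym (Vec.tabulate-∘ proj₁ g)) (Vec.tabulate∘lookup t))) st)

  linked-sym : ∀ {A B : Structure L} {n r a b} (f : NeighbourhoodIso A B {n} r a b) {s u v} → s ≤ r →
    Transfer.Linked f s u v → Transfer.Linked (NeighbourhoodIso-sym f) s v u
  linked-sym f s≤r (Transfer.linked p q nb refl) =
    Transfer.linked q p (neighbourhood-mono s≤r q) (Inverse.inverseʳ (NeighbourhoodIso.iso f) refl)

  -- `s + radius φ` is the budget: each `near` moves one unit from the radius to the depth `s`, and
  -- all variables in scope stay linked at depth `s`.
  transfer : ∀ {A B : Structure L} {n r a b} (f : NeighbourhoodIso A B {n} r a b) →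
    ∀ {m s} (φ : Guarded L m) {x y} → (∀ i → Transfer.Linked f s (lookup x i) (lookup y i)) →
    s + radius φ ≤ r → A ⊩ φ [ x ] → B ⊩ φ [ y ]
  transfer f falsum         ls _ ()
  transfer f (equal u v)    ls _ h = to (Transfer.linked-≡ f (ls u) (ls v)) h
  transfer f (atom S xs)    ls _ h =
    to (Transfer.linked-rel f {S = S} (lookup-map-all (Transfer.Linked f _) ls xs)) h
  transfer f (not φ)        ls ≤r h h′ =
    h (transfer (NeighbourhoodIso-sym f) φ (λ i → linked-sym f (ℕ.m+n≤o⇒m≤o _ ≤r) (ls i)) ≤r h′)
  transfer {r = r} f {s = s} (φ and ψ) ls ≤r (h , h′) =
      transfer f φ ls (ℕ.≤-trans (ℕ.+-monoʳ-≤ s (ℕ.m≤m⊔n (radius φ) (radius ψ))) ≤r) h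
    , transfer f ψ ls (ℕ.≤-trans (ℕ.+-monoʳ-≤ s (ℕ.m≤n⊔m (radius φ) (radius ψ))) ≤r) h′
  transfer f {s = s} (φ or ψ) ls ≤r (inj₁ h) =
    inj₁ (transfer f φ ls (ℕ.≤-trans (ℕ.+-monoʳ-≤ s (ℕ.m≤m⊔n (radius φ) (radius ψ))) ≤r) h)
  transfer f {s = s} (φ or ψ) ls ≤r (inj₂ h) =
    inj₂ (transfer f ψ ls (ℕ.≤-trans (ℕ.+-monoʳ-≤ s (ℕ.m≤n⊔m (radius φ) (radius ψ))) ≤r) h)
  transfer {r = r} f {s = s} (near S i x φ) ls ≤r (t , st , tᵢ≡ , h) =
    let t′ , st′ , t′ᵢ≡ , lt = Transfer.linked-tuple f {S = S} (ℕ.m+n≤o⇒m≤o (suc s) ≤r′) (ls x) st tᵢ≡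
    in t′ , st′ , t′ᵢ≡ , transfer f φ (lookup-++-all (Transfer.Linked f (suc s)) {t = t} {t′} lt
                                        (Transfer.linked-suc f ∘ ls)) ≤r′ h
    where
    ≤r′ : suc s + radius φ ≤ r
    ≤r′ = subst (_≤ r) (ℕ.+-suc s (radius φ)) ≤r

  guarded-local : ∀ {n} (φ : Guarded L n) → Local (formula φ)
  guarded-local φ = radius φ , λ A B a b f → ⇔.trans (⊨-formula A φ) (⇔.trans
    (mk⇔ (transfer f φ (centre-linked f) ℕ.≤-refl)
         (transfer (NeighbourhoodIso-sym f) φ (centre-linked (NeighbourhoodIso-sym f)) ℕ.≤-refl))
    (⇔.sym (⊨-formula B φ)))
    where
    centre-linked : ∀ {A B : Structure L} {n r a b} (f : NeighbourhoodIso A B {n} r a b) i →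
      Transfer.Linked f 0 (lookup a i) (lookup b i)
    centre-linked f i = Transfer.linked (centre i) (centre i) (centre i) (NeighbourhoodIso.centres f i)

-- The ball around a tuple

module _ {L : Language} where
  open Language L

  symbols : ∀ {n} → Formula L n → List Sym
  symbols (x ≐ y)    = []
  symbols (S ⦅ _ ⦆)  = S ∷ []
  symbols (¬′ φ)     = symbols φ
  symbols (φ ∧′ ψ)   = symbols φ ++ symbols ψ
  symbols (∃′ φ)     = symbols φ

  module _ (A : Structure L) (Ss : List Sym) where
    open Structure A

    -- Unlike `Adjacent`, this admits `u` equal to `v` and sees only the symbols in `Ss`, given by
    -- their index. The search is thus finite, and `Meets` is decidable.
    Meets : Carrier → Carrier → Set
    Meets u v = ∃[ s ] let S = List.lookup Ss s in
      ∃[ i ] ∃[ j ] ∃[ t ] rel S t × lookup t i ≡ u × lookup t j ≡ v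

    meets? : ∀ u v → Dec (Meets u v)
    meets? u v = Fin.any? λ s → Fin.any? λ i → Fin.any? λ j → ∃? (finiteVec finite _) λ t →
      rel? _ t ×-dec (lookup t i ≟ u) ×-dec (lookup t j ≟ v)
      where open Finite finite

    rel⇒meets : ∀ {S} t → S ∈ˡ Ss → rel S t → ∀ i j → Meets (lookup t i) (lookup t j)
    rel⇒meets t S∈ st i j = Anyˡ.index S∈ , meets (Anyˡ.lookup-index S∈) t st i j
      where
      meets : ∀ {S S′} → S ≡ S′ → (t : Vec Carrier (arity S)) → rel S t → ∀ i j →
        ∃[ i′ ] ∃[ j′ ] ∃[ t′ ] rel S′ t′ × lookup t′ i′ ≡ lookup t i × lookup t′ j′ ≡ lookup t j
      meets refl t st i j = i , j , t , st , refl , refl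

    -- Membership of a symbol in Ss is undecidable, so the relations outside Ss
    -- cannot be emptied; keeping only the tuples whose entries meet pairwise
    -- also leaves no adjacencies but those due to Ss.
    trim : Structure L
    trim = record
      { Carrier    = Carrier
      ; finite     = finite
      ; inhabitant = inhabitant
      ; rel        = λ S t → rel S t × ∀ i j → Meets (lookup t i) (lookup t j)
      ; rel?       = λ S t → rel? S t ×-dec Fin.all? (λ i → Fin.all? (λ j → meets? (lookup t i) (lookup t j)))
      }

    ⊨-trim : ∀ {n} (φ : Formula L n) → symbols φ ⊆ Ss → ∀ {a} → A ⊨ φ [ a ] ⇔ trim ⊨ φ [ a ]
    ⊨-trim (x ≐ y)    φ⊆ = ⇔.refl
    ⊨-trim (S ⦅ xs ⦆) φ⊆ = mk⇔ (λ st → st , rel⇒meets _ (φ⊆ (Anyˡ.here refl)) st) proj₁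
    ⊨-trim (¬′ φ)     φ⊆ = mk⇔ (_∘ from (⊨-trim φ φ⊆)) (_∘ to (⊨-trim φ φ⊆))
    ⊨-trim (φ ∧′ ψ)   φ⊆ = ⊨-trim φ (φ⊆ ∘ ∈-++⁺ˡ) ×-⇔ ⊨-trim ψ (φ⊆ ∘ ∈-++⁺ʳ (symbols φ))
    ⊨-trim (∃′ φ)     φ⊆ = mk⇔ (λ (v , h) → v , to (⊨-trim φ φ⊆) h) (λ (v , h) → v , from (⊨-trim φ φ⊆) h)

    module _ {m} (b : Vec Carrier m) where

      -- Membership in a `Neighbourhood` of `trim` involves a search through all symbols. The ball
      -- rests on `Meets` instead, so it is decidable and can be spelled out as a formula.
      Ball : ℕ → Pred Carrier 0ℓ
      Ball zero    v = ∃[ i ] lookup b i ≡ v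
      Ball (suc r) v = Ball r v ⊎ ∃[ u ] Ball r u × Meets u v

      ball? : ∀ r → Decidable (Ball r)
      ball? zero    v = Fin.any? (λ i → Finite._≟_ finite (lookup b i) v)
      ball? (suc r) v = ball? r v ⊎-dec ∃? finite (λ u → ball? r u ×-dec meets? u v)

      ball-mono : ∀ {r s v} → r ≤ s → Ball r v → Ball s v
      ball-mono {s = zero}  z≤n       c                  = c
      ball-mono {s = suc _} z≤n       c                  = inj₁ (ball-mono z≤n c)
      ball-mono             (s≤s r≤s) (inj₁ c)           = inj₁ (ball-mono r≤s c)
      ball-mono             (s≤s r≤s) (inj₂ (u , c , e)) = inj₂ (u , ball-mono r≤s c , e)

      neighbourhood⇒ball : ∀ {r v} → Neighbourhood trim b r v → Ball r v
      neighbourhood⇒ball (centre i) = ball-mono z≤n (i , refl)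
      neighbourhood⇒ball (step nb (_ , _ , t , (_ , meets) , u∈ , v∈)) =
        inj₂ (_ , neighbourhood⇒ball nb , subst₂ Meets (≡-sym (Anyᵛ.lookup-index u∈)) (≡-sym (Anyᵛ.lookup-index v∈)) (meets _ _))

      -- Structures have an inhabitant; the centre with index `i₀` provides that of the ball.
      module BallStructure (r : ℕ) (i₀ : Fin m) where

        BallVertex : Set
        BallVertex = [ v ∈ Carrier ∣ Ball r v ]

        centres : Vec BallVertex m
        centres = tabulate (λ i → lookup b i ,ʳ [ ball-mono z≤n (i , refl) ])

        lookup-centres : ∀ i → value (lookup centres i) ≡ lookup b i
        lookup-centres i = cong value (Vec.lookup∘tabulate _ i)

        ballStructure : Structure L
        ballStructure = record
          { Carrier    = BallVertex
          ; finite     = finiteRefinement finite (ball? r)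
          ; inhabitant = lookup centres i₀
          ; rel        = λ S t → Structure.rel trim S (Vec.map value t)
          ; rel?       = λ S t → Structure.rel? trim S (Vec.map value t)
          }

        -- A path survives in the ball only if the entire tuple behind each of its edges does. That
        -- tuple contains `u`, which is one step nearer to the centres, and its entries meet
        -- pairwise in `trim`; so all of them are in the ball as long as the path has length at most
        -- `r`.
        lift : ∀ {s v} .(c : Ball r v) → s ≤ r → Neighbourhood trim b s v → Neighbourhood ballStructure centres s (v ,ʳ [ c ])
        lift c s≤r (centre i) = subst (Neighbourhood _ _ _) (Vec.lookup∘tabulate _ i) (centre i)
        lift {v = v} c s≤r (step {u = u} nb (u≢v , S , t , (st , meets) , u∈ , v∈)) =
          step {u = u ,ʳ [ ball u∈ ]} (lift (ball u∈) (ℕ.<⇒≤ s≤r) nb)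
            (u≢v ∘ cong value , S , t′ , subst (Structure.rel trim S) (≡-sym map-t′) (st , meets) , ∈t′ u∈ , ∈t′ v∈)
          where
          ball-t : ∀ j → Ball r (lookup t j)
          ball-t j = ball-mono s≤r (inj₂ (u , neighbourhood⇒ball nb ,
            subst (λ w → Meets w (lookup t j)) (≡-sym (Anyᵛ.lookup-index u∈)) (meets _ j)))
          ball : ∀ {w} → w ∈ᵛ t → Ball r w
          ball w∈ = subst (Ball r) (≡-sym (Anyᵛ.lookup-index w∈)) (ball-t _)
          t′ = tabulate (λ j → lookup t j ,ʳ [ ball-t j ])
          map-t′ : Vec.map value t′ ≡ t
          map-t′ = trans (≡-sym (Vec.tabulate-∘ value _)) (Vec.tabulate∘lookup t)
          ∈t′ : ∀ {w} .{c : Ball r w} → w ∈ᵛ t → (w ,ʳ [ c ]) ∈ᵛ t′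
          ∈t′ {w} {c} w∈ = subst (_∈ᵛ t′) (trans (Vec.lookup∘tabulate _ (Anyᵛ.index w∈)) (lemma (≡-sym (Anyᵛ.lookup-index w∈))))
                             (∈-lookup (Anyᵛ.index w∈) t′)
            where
            lemma : ∀ {w′} .{c′ : Ball r w′} → w′ ≡ w → (w′ ,ʳ [ c′ ]) ≡ (w ,ʳ [ c ])
            lemma refl = refl

        project : ∀ {s v} → Neighbourhood ballStructure centres s v → Neighbourhood trim b s (value v)
        project (centre i) = subst (Neighbourhood _ _ _) (≡-sym (lookup-centres i)) (centre i)
        project (step nb (u≢v , S , t , st , u∈ , v∈)) = step (project nb)
          ((λ { refl → u≢v refl }) , S , Vec.map value t , st , ∈-map⁺ value u∈ , ∈-map⁺ value v∈)

        ballIso : NeighbourhoodIso trim ballStructure r b centres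
        ballIso = record
          { iso       = record
            { to        = λ (v , nb) → (v ,ʳ [ neighbourhood⇒ball nb ]) , lift (neighbourhood⇒ball nb) ℕ.≤-refl nb
            ; from      = λ (v , nb) → value v , project nb
            ; to-cong   = λ { refl → refl }
            ; from-cong = λ { refl → refl }
            ; inverse   = (λ { refl → refl }) , (λ { refl → refl })
            }
          ; preserves = λ S t → subst (λ u → Structure.rel trim S (Vec.map proj₁ t) ⇔ Structure.rel trim S u) (Vec.map-∘ value _ t) ⇔.refl
          ; centres   = λ i → ≡-sym (Vec.lookup∘tabulate _ i)
          }

  open BallStructure public using () renaming (ballStructure to ball; centres to ballCentres)

  -- Locality compares the ball with `trim`, not with `A`: in `A`, symbols foreign to φ may draw
  -- further vertices into the neighbourhood of `b`. Passing from `A` to `trim` preserves φ because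
  -- of its symbols alone.
  ⊨-ball : ∀ {m} (φ : Formula L m) ((r , _) : Local φ) (A : Structure L) (b : Vec (Structure.Carrier A) m) i₀ →
    A ⊨ φ [ b ] ⇔ ball A (symbols φ) b r i₀ ⊨ φ [ ballCentres A (symbols φ) b r i₀ ]
  ⊨-ball φ (r , local) A b i₀ =
    ⇔.trans (⊨-trim A (symbols φ) φ id) (local _ _ _ _ (BallStructure.ballIso A (symbols φ) b r i₀))

-- Local formulas of A interpreted in A ⋆ G

module _ {L : Language} {k : ℕ} .{{_ : NonZero k}} where
  private
    Base = BaseLanguage L k
    Star = StarLanguage L k
  open Language Base

  -- Defined by cases because the arities in the two languages agree definitionally only once the
  -- symbol is known.
  baseAtom : ∀ {n} (S : Sym) → Vec (Fin n) (arity S) → Guarded Star n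
  baseAtom (sym S) = atom (sym S)
  baseAtom R       = atom R

  baseNear : ∀ {n} (S : Sym) → Fin (arity S) → Fin n → Guarded Star (arity S + n) → Guarded Star n
  baseNear (sym S) = near (sym S)
  baseNear R       = near R

  -- A formula with one more free variable, in every context extending the
  -- present one by way of a renaming.
  Continuation : ℕ → Set
  Continuation n = ∀ n′ → (Fin n → Fin n′) → Fin n′ → Guarded Star n′

  -- Each tuple from a gadget copy has a non-root entry, which is an external vertex. Requiring
  -- `Int` of every entry therefore leaves exactly the tuples of `A`.
  internalAt : ∀ {m n} → Continuation n → Fin m → Guarded Star (m + n)
  internalAt {m} {n} κ j = all (λ i → atom Int ((i ↑ˡ n) ∷ [])) and κ _ (m ↑ʳ_) (j ↑ˡ n)

  ∃meeting : ∀ {n} → List Sym → Fin n → Continuation n → Guarded Star n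
  ∃meeting Ss x κ = any λ s → let S = List.lookup Ss s in any λ i → any λ j → baseNear S i x (internalAt κ j)

  -- The vertex found is an old variable in one branch and a new one, in a longer context, in
  -- another. Hence the remainder of the formula is a continuation, instantiated in each branch.
  ∃ball : ∀ {m n} → List Sym → ℕ → Vec (Fin n) m → Continuation n → Guarded Star n
  ∃ball Ss zero    c κ = any λ i → κ _ id (lookup c i)
  ∃ball Ss (suc r) c κ =
    ∃ball Ss r c κ or ∃ball Ss r c (λ _ σ u → ∃meeting Ss u (λ _ σ′ v → κ _ (σ′ ∘ σ) v))

  -- The quantifiers of φ range over the ball around the variables c; the
  -- variables of φ are interpreted by e.
  relativise : ∀ {m n l} → List Sym → ℕ → Vec (Fin n) m → Formula Base l → Vec (Fin n) l → Guarded Star n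
  relativise Ss r c (x ≐ y)    e = equal (lookup e x) (lookup e y)
  relativise Ss r c (S ⦅ xs ⦆) e = baseAtom S (Vec.map (lookup e) xs)
  relativise Ss r c (¬′ φ)     e = not (relativise Ss r c φ e)
  relativise Ss r c (φ ∧′ ψ)   e = relativise Ss r c φ e and relativise Ss r c ψ e
  relativise Ss r c (∃′ φ)     e =
    ∃ball Ss r c (λ _ σ v → relativise Ss r (Vec.map σ c) φ (v ∷ Vec.map σ e))

  -- Correctness of the relativised formula

  module Interpretation (A : Structure Base) (G : Gadget L k) (free : RootTupleFree G) where
    open Construction A G
    private
      module A = Structure A
      module G = Gadget G

    internal-injective : ∀ {x y} → internal x ≡ internal y → x ≡ y
    internal-injective refl = refl

    map-internal-injective : ∀ {n} {xs ys : Vec A.Carrier n} → Vec.map internal xs ≡ Vec.map internal ys → xs ≡ ys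
    map-internal-injective {xs = []}    {[]}    _  = refl
    map-internal-injective {xs = _ ∷ _} {_ ∷ _} eq =
      cong₂ _∷_ (internal-injective (Vec.∷-injectiveˡ eq)) (map-internal-injective (Vec.∷-injectiveʳ eq))

    class-internal : ∀ {e v x} → [ e , v ]ᵍ ≡ internal x → G.IsRoot v
    class-internal {v = v} eq with G.isRoot? v
    class-internal eq | yes root = root
    class-internal () | no _

    roots-internal : ∀ {n} e {vs : Vec G.Carrier n} {xs} → Vec.map internal xs ≡ Vec.map [ e ,_]ᵍ vs → Allᵛ.All G.IsRoot vs
    roots-internal e {[]}     {[]}     _  = Allᵛ.[]
    roots-internal e {_ ∷ _} {_ ∷ _} eq =
      class-internal (≡-sym (Vec.∷-injectiveˡ eq)) Allᵛ.∷ roots-internal e (Vec.∷-injectiveʳ eq)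

    baseRelation : (S : Sym) → Pred (Vec Vertex (arity S)) 0ℓ
    baseRelation (sym S) = relation (sym S)
    baseRelation R       = relation R

    ⊩-baseAtom : ∀ {n} S xs {a : Vec Vertex n} → star ⊩ baseAtom S xs [ a ] ⇔ baseRelation S (Vec.map (lookup a) xs)
    ⊩-baseAtom (sym S) xs = ⇔.refl
    ⊩-baseAtom R       xs = ⇔.refl

    ⊩-baseNear : ∀ {n} S i x φ {a : Vec Vertex n} → star ⊩ baseNear S i x φ [ a ] ⇔
      (∃[ t ] baseRelation S t × lookup t i ≡ lookup a x × star ⊩ φ [ t ++ᵛ a ])
    ⊩-baseNear (sym S) i x φ = ⇔.refl
    ⊩-baseNear R       i x φ = ⇔.refl

    -- A gadget tuple whose classes are all internal consists of roots, which `free` forbids; so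
    -- gadget copies add no relations among internal vertices.
    baseRelation-internal : ∀ S {as} → baseRelation S (Vec.map internal as) ⇔ A.rel S as
    baseRelation-internal (sym S) {as} = mk⇔ forth (λ s → inj₁ (as , s , refl))
      where
      forth : relation (sym S) (Vec.map internal as) → A.rel (sym S) as
      forth (inj₁ (_ , s , eq))      = subst (A.rel (sym S)) (≡-sym (map-internal-injective eq)) s
      forth (inj₂ (e , vs , s , eq)) = contradiction (roots-internal e eq) (free S vs s)
    baseRelation-internal R {as} = mk⇔
      (λ (_ , s , eq) → subst (A.rel R) (≡-sym (map-internal-injective eq)) s)
      (λ s → as , s , refl)

    internal-tuple : ∀ {n} (t : Vec Vertex n) → (∀ i → Internal (lookup t i)) → ∃[ as ] t ≡ Vec.map internal as
    internal-tuple []      int = [] , refl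
    internal-tuple (_ ∷ t) int with int zero | internal-tuple t (int ∘ suc)
    ... | a , refl | as , refl = a ∷ as , refl

    lookup-renamed : ∀ {n n′ q} {a : Vec Vertex n} {a′ : Vec Vertex n′} {σ} (c : Vec (Fin n) q) {f : Fin q → A.Carrier} →
      (∀ i → lookup a′ (σ i) ≡ lookup a i) → (∀ i → lookup a (lookup c i) ≡ internal (f i)) →
      ∀ i → lookup a′ (lookup (Vec.map σ c) i) ≡ internal (f i)
    lookup-renamed {a′ = a′} {σ} c a′≡ ac≡ i =
      trans (cong (lookup a′) (Vec.lookup-map i σ c)) (trans (a′≡ (lookup c i)) (ac≡ i))

    module _ (Ss : List Sym) where

      -- Correctness of κ is asked only for vertices in `C`: a vertex outside the ball is not an
      -- element of the ball structure and cannot interpret a variable of φ.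
      Interprets : ∀ {n} → Vec Vertex n → Pred A.Carrier 0ℓ → Continuation n → Pred A.Carrier 0ℓ → Set
      Interprets a C κ P = ∀ {n′} σ (a′ : Vec Vertex n′) x {u} → (∀ i → lookup a′ (σ i) ≡ lookup a i) →
        lookup a′ x ≡ internal u → C u → star ⊩ κ n′ σ x [ a′ ] ⇔ P u

      ⊩-∃meeting : ∀ {n} {a : Vec Vertex n} {x u κ P} → lookup a x ≡ internal u → Interprets a (Meets A Ss u) κ P →
        star ⊩ ∃meeting Ss x κ [ a ] ⇔ (∃[ v ] Meets A Ss u v × P v)
      ⊩-∃meeting {n} {a} {x} {u} {κ} {P} ax≡ spec = mk⇔ forth back
        where
        forth : star ⊩ ∃meeting Ss x κ [ a ] → ∃[ v ] Meets A Ss u v × P v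
        forth h
          with s , h ← to (⊩-any star _) h
          with i , h ← to (⊩-any star _) h
          with j , h ← to (⊩-any star _) h
          with t , st , tᵢ≡ , int , h ← to (⊩-baseNear (List.lookup Ss s) i x (internalAt κ j)) h
          with as , refl ← internal-tuple t (λ i → subst Internal (Vec.lookup-++ˡ t a i) (to (⊩-all star _) int i))
          = lookup as j , meets , to (spec _ _ _ (Vec.lookup-++ʳ t a)
              (trans (Vec.lookup-++ˡ t a j) (Vec.lookup-map j internal as)) meets) h
          where
          meets : Meets A Ss u (lookup as j)
          meets = s , i , j , as , to (baseRelation-internal (List.lookup Ss s)) st
                , internal-injective (trans (≡-sym (Vec.lookup-map i internal as)) (trans tᵢ≡ ax≡)) , refl
        back : ∃[ v ] Meets A Ss u v × P v → star ⊩ ∃meeting Ss x κ [ a ]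
        back (v , meets@(s , i , j , as , st , refl , refl) , p) =
          from (⊩-any star _) (s , from (⊩-any star _) (i , from (⊩-any star _) (j ,
            from (⊩-baseNear (List.lookup Ss s) i x (internalAt κ j)) (t , from (baseRelation-internal (List.lookup Ss s)) st
              , trans (Vec.lookup-map i internal as) (≡-sym ax≡)
              , from (⊩-all star _) (λ j′ → lookup as j′ , at j′)
              , from (spec _ _ _ (Vec.lookup-++ʳ t a) (at j) meets) p))))
          where
          t = Vec.map internal as
          at : ∀ j → lookup (t ++ᵛ a) (j ↑ˡ n) ≡ internal (lookup as j)
          at j = trans (Vec.lookup-++ˡ t a j) (Vec.lookup-map j internal as)

      module _ {m} (b : Vec A.Carrier m) where

        ⊩-∃ball : ∀ r {n} {a : Vec Vertex n} {c κ P} → (∀ i → lookup a (lookup c i) ≡ internal (lookup b i)) →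
          Interprets a (Ball A Ss b r) κ P → star ⊩ ∃ball Ss r c κ [ a ] ⇔ (∃[ v ] Ball A Ss b r v × P v)
        ⊩-∃ball zero {a = a} {c} {κ} {P} ac≡ spec = ⇔.trans (⊩-any star _) (mk⇔
          (λ (i , h) → lookup b i , (i , refl) , to (spec id a (lookup c i) (λ _ → refl) (ac≡ i) (i , refl)) h)
          (λ { (_ , (i , refl) , p) → i , from (spec id a (lookup c i) (λ _ → refl) (ac≡ i) (i , refl)) p }))
        ⊩-∃ball (suc r) {a = a} {c} {κ} {P} ac≡ spec = mk⇔
          (λ { (inj₁ h) → let v , v∈ , p = to here h in v , inj₁ v∈ , p
             ; (inj₂ h) → let u , u∈ , v , uv , p = to beyond h in v , inj₂ (u , u∈ , uv) , p })
          (λ { (v , inj₁ v∈ , p) → inj₁ (from here (v , v∈ , p))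
             ; (v , inj₂ (u , u∈ , uv) , p) → inj₂ (from beyond (u , u∈ , v , uv , p)) })
          where
          here = ⊩-∃ball r {κ = κ} {P} ac≡ (λ σ a′ x a′≡ x≡ u∈ → spec σ a′ x a′≡ x≡ (inj₁ u∈))
          -- The induction is general in the predicate: here `u` is the vertex sought, and the last
          -- step from `u` to `v` is absorbed into the predicate.
          beyond = ⊩-∃ball r {P = λ u → ∃[ v ] Meets A Ss u v × P v} ac≡ (λ σ a′ x a′≡ x≡ u∈ →
            ⊩-∃meeting {κ = λ _ σ′ v → κ _ (σ′ ∘ σ) v} {P} x≡ (λ σ′ a″ y a″≡ y≡ uv →
              spec (σ′ ∘ σ) a″ y (λ i → trans (a″≡ (σ i)) (a′≡ i)) y≡ (inj₂ (_ , u∈ , uv))))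

        module _ (r : ℕ) (i₀ : Fin m) where
          open BallStructure A Ss b r i₀

          ⊩-relativise : ∀ {n l} (φ : Formula Base l) → symbols φ ⊆ Ss → ∀ {a : Vec Vertex n} {c e} {y : Vec BallVertex l} →
            (∀ i → lookup a (lookup c i) ≡ internal (lookup b i)) →
            (∀ i → lookup a (lookup e i) ≡ internal (value (lookup y i))) →
            star ⊩ relativise Ss r c φ e [ a ] ⇔ ballStructure ⊨ φ [ y ]
          ⊩-relativise (x₁ ≐ x₂) φ⊆ {y = y} ac≡ ae≡ = subst₂ (λ v w → (v ≡ w) ⇔ lookup y x₁ ≡ lookup y x₂) (≡-sym (ae≡ x₁)) (≡-sym (ae≡ x₂))
            (mk⇔ (λ eq → value-injective (internal-injective eq)) (cong (internal ∘ value)))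
          ⊩-relativise (S ⦅ xs ⦆) φ⊆ {a} {c} {e} {y} ac≡ ae≡ = ⇔.trans (⊩-baseAtom S _)
            (subst (λ t → baseRelation S t ⇔ _) (≡-sym xs≡)
              (⇔.trans (baseRelation-internal S)
                (mk⇔ (λ s → s , rel⇒meets A Ss _ (φ⊆ (Anyˡ.here refl)) s) proj₁)))
            where
            open ≡-Reasoning
            xs≡ : Vec.map (lookup a) (Vec.map (lookup e) xs) ≡ Vec.map internal (Vec.map value (Vec.map (lookup y) xs))
            xs≡ = begin
              Vec.map (lookup a) (Vec.map (lookup e) xs)                    ≡⟨ Vec.map-∘ (lookup a) (lookup e) xs ⟨
              Vec.map (lookup a ∘ lookup e) xs                              ≡⟨ Vec.map-cong ae≡ xs ⟩
              Vec.map (internal ∘ value ∘ lookup y) xs                      ≡⟨ Vec.map-∘ internal (value ∘ lookup y) xs ⟩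
              Vec.map internal (Vec.map (value ∘ lookup y) xs)              ≡⟨ cong (Vec.map internal) (Vec.map-∘ value (lookup y) xs) ⟩
              Vec.map internal (Vec.map value (Vec.map (lookup y) xs))      ∎
          ⊩-relativise (¬′ φ)     φ⊆ ac≡ ae≡ = mk⇔ (_∘ from (⊩-relativise φ φ⊆ ac≡ ae≡)) (_∘ to (⊩-relativise φ φ⊆ ac≡ ae≡))
          ⊩-relativise (φ ∧′ ψ)   φ⊆ ac≡ ae≡ =
            ⊩-relativise φ (φ⊆ ∘ ∈-++⁺ˡ) ac≡ ae≡ ×-⇔ ⊩-relativise ψ (φ⊆ ∘ ∈-++⁺ʳ (symbols φ)) ac≡ ae≡
          ⊩-relativise (∃′ φ)     φ⊆ {a} {c} {e} {y} ac≡ ae≡ = ⇔.trans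
            (⊩-∃ball r {P = P} ac≡ (λ σ a′ x {u} a′≡ x≡ u∈ →
              ⇔.trans (⊩-relativise φ φ⊆ (lookup-renamed {a = a} {a′} {σ} c a′≡ ac≡)
                        (λ { zero → x≡ ; (suc i) → lookup-renamed {a = a} {a′} {σ} e a′≡ ae≡ i }))
                (mk⇔ (λ h → (u ,ʳ [ u∈ ]) , refl , h) (λ { (_ , refl , h) → h }))))
            (mk⇔ (λ { (_ , _ , w , refl , h) → w , h })
                 -- Membership in the ball is irrelevant inside the refinement; `ball?` recovers a
                 -- usable proof.
                 (λ { (w@(v ,ʳ [ v∈ ]) , h) → v , recompute (ball? A Ss b r v) v∈ , w , refl , h }))
            where
            P : Pred A.Carrier 0ℓ
            P u = ∃[ w ] value w ≡ u × ballStructure ⊨ φ [ w ∷ y ]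

-- Profiles and blocks

module _ {L : Language} {k : ℕ} .{{_ : NonZero k}} where
  private
    Base = BaseLanguage L k
    Star = StarLanguage L k

  BlockContinuation : ℕ → ℕ → Set
  BlockContinuation n l = ∀ n′ → (Fin n → Fin n′) → Vec (Fin n′) l → Guarded Star n′

  ρ-variables : ∀ n → Vec (Fin (suc k + n)) k
  ρ-variables n = tabulate (λ j → suc (j ↑ˡ n))

  -- The block of an internal `x` is `x` itself. For an external `x`, the tuple of the symbol ρ with
  -- head `x` has the vertex tuple ρ(x) as its tail; it is unique, so `near` merely names it.
  ∃blocks : ∀ {q n} (I : Subset q) → Vec (Fin n) q → BlockContinuation n (blocksLength k I) → Guarded Star n
  ∃blocks         []            []       κ = κ _ id []
  ∃blocks         (inside ∷ I)  (x ∷ xs) κ = ∃blocks I xs (λ _ σ ys → κ _ σ (σ x ∷ ys))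
  ∃blocks {n = n} (outside ∷ I) (x ∷ xs) κ = near ρ zero x
    (∃blocks I (Vec.map (suc k ↑ʳ_) xs) (λ _ σ ys → κ _ (σ ∘ (suc k ↑ʳ_)) (Vec.map σ (ρ-variables n) ++ᵛ ys)))

  -- The relation ρ holds only with an external vertex in front, so it also certifies that both
  -- variables are external.
  sameρ : ∀ {n} → Fin n → Fin n → Guarded Star n
  sameρ {n} x y = near ρ zero x (atom ρ ((suc k ↑ʳ y) ∷ ρ-variables n))

  signed : ∀ {n} {P : Set} → Dec P → Guarded Star n → Guarded Star n
  signed (yes _) φ = φ
  signed (no _)  φ = not φ

  hasProfile : ∀ {p} → Profile p → Guarded Star p
  hasProfile π = all (λ i → signed (i ∈ˢ? I) (atom Int (i ∷ [])))
             and all (λ i → all (λ j → signed (sameClass? i j) (sameρ i j)))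
    where open Profile π

  -- Supplies the centre from which the ball gets its inhabitant; it exists as `p` and `k` are
  -- positive.
  blockVariable : ∀ {p} .{{_ : NonZero p}} (I : Subset p) → Fin (blocksLength k I)
  blockVariable (inside ∷ I)  = zero
  blockVariable (outside ∷ I) = fromℕ< (>-nonZero⁻¹ k) ↑ˡ blocksLength k I
  blockVariable []            with () ← >-nonZero⁻¹ 0

  interpretation : ∀ {p} (I : Subset p) (φ : Formula Base (blocksLength k I)) → Local φ → Guarded Star p
  interpretation I φ (r , _) = ∃blocks I (allFin _) (λ _ _ xs → relativise (symbols φ) r xs φ xs)

  module Counting (A : Structure Base) (G : Gadget L k) (free : RootTupleFree G) where
    open Construction A G
    open Interpretation A G free
    private
      module A = Structure A
      module G = Gadget G

    map-lookup-ρ-variables : ∀ {n} x (xs : Vec Vertex k) (a : Vec Vertex n) →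
      Vec.map (lookup (x ∷ xs ++ᵛ a)) (ρ-variables n) ≡ xs
    map-lookup-ρ-variables {n} x xs a = begin
      Vec.map (lookup (x ∷ xs ++ᵛ a)) (ρ-variables n)  ≡⟨ Vec.tabulate-∘ (lookup (x ∷ xs ++ᵛ a)) (λ j → suc (j ↑ˡ n)) ⟨
      tabulate (λ j → lookup (xs ++ᵛ a) (j ↑ˡ n))      ≡⟨ Vec.tabulate-cong (Vec.lookup-++ˡ xs a) ⟩
      tabulate (lookup xs)                             ≡⟨ Vec.tabulate∘lookup xs ⟩
      xs                                               ∎
      where open ≡-Reasoning

    class-cases : ∀ e v → Internal [ e , v ]ᵍ ⊎ ∃[ w ] [ e , v ]ᵍ ≡ external e w
    class-cases e v with G.isRoot? v
    ... | yes (i , _) = inj₁ (lookup (value e) i , refl)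
    ... | no ¬root    = inj₂ ((v ,ʳ [ ¬root ]) , refl)

    relation-ρ : ∀ {x xs} → relation ρ (x ∷ xs) ⇔ (∃[ e ] ∃[ v ] x ≡ external e v × xs ≡ Vec.map internal (value e))
    relation-ρ {x} {xs} = mk⇔ forth (λ { (e , v , refl , xs≡) → e , value v
        , (λ int → ¬internal (subst Internal (class-representative (external e v)) int))
        , ≡-sym (class-representative (external e v)) , xs≡ })
      where
      ¬internal : ∀ {e v} → ¬ Internal (external e v)
      ¬internal (_ , ())
      forth : relation ρ (x ∷ xs) → ∃[ e ] ∃[ v ] x ≡ external e v × xs ≡ Vec.map internal (value e)
      forth (e , v , ¬int , x≡ , xs≡) with class-cases e v
      ... | inj₁ int       = contradiction int ¬int
      ... | inj₂ (w , eq) = e , w , trans x≡ eq , xs≡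

    external-injective : ∀ {e f v w} → external e v ≡ external f w → e ≡ f
    external-injective refl = refl

    Sameρ-external : ∀ {x y} → Sameρ x y ⇔ (∃[ e ] ∃[ v ] ∃[ w ] x ≡ external e v × y ≡ external e w)
    Sameρ-external {external e v} {external _ w} = mk⇔ (λ { refl → e , v , w , refl , refl }) (λ { (_ , _ , _ , refl , refl) → refl })
    Sameρ-external {internal _}                  = mk⇔ (λ ()) (λ { (_ , _ , _ , () , _) })
    Sameρ-external {external _ _} {internal _}   = mk⇔ (λ ()) (λ { (_ , _ , _ , _ , ()) })

    ⊩-sameρ : ∀ {n} x y {a : Vec Vertex n} → star ⊩ sameρ x y [ a ] ⇔ Sameρ (lookup a x) (lookup a y)
    ⊩-sameρ {n} x y {a} = ⇔.trans (mk⇔ forth back) (⇔.sym Sameρ-external)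
      where
      Same = ∃[ e ] ∃[ v ] ∃[ w ] lookup a x ≡ external e v × lookup a y ≡ external e w
      forth : star ⊩ sameρ x y [ a ] → Same
      forth (t ∷ ts , ρt , t≡ , ρy)
        with e , v , refl , refl ← to relation-ρ ρt
        with f , w , y≡ , ts≡ ← to relation-ρ ρy
        with refl ← value-injective {v = e} {f} (map-internal-injective (trans (≡-sym (map-lookup-ρ-variables t ts a)) ts≡))
        = e , v , w , ≡-sym t≡ , trans (≡-sym (Vec.lookup-++ʳ ts a y)) y≡
      back : Same → star ⊩ sameρ x y [ a ]
      back (e , v , w , x≡ , y≡) = (external e v ∷ ts) , from relation-ρ (e , v , refl , refl) , ≡-sym x≡
          , from relation-ρ (e , w , trans (Vec.lookup-++ʳ ts a y) y≡ , map-lookup-ρ-variables (external e v) ts a)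
        where ts = Vec.map internal (value e)

    ⊩-signed : ∀ {n} {P : Set} (P? : Dec P) φ {a : Vec Vertex n} → star ⊩ signed P? φ [ a ] ⇔ (P ⇔ star ⊩ φ [ a ])
    ⊩-signed (yes p) φ = mk⇔ (λ h → mk⇔ (λ _ → h) (λ _ → p)) (λ e → to e p)
    ⊩-signed (no ¬p) φ = mk⇔ (λ ¬h → mk⇔ (λ p → contradiction p ¬p) (λ h → contradiction h ¬h)) (λ e h → ¬p (from e h))

    ⊩-hasProfile : ∀ {p} (π : Profile p) {a} → star ⊩ hasProfile π [ a ] ⇔ HasProfile π a
    ⊩-hasProfile π =
      ⇔.trans (⊩-all star _) (Π-⇔ λ i → ⊩-signed (i ∈ˢ? I) (atom Int (i ∷ []))) ×-⇔
      ⇔.trans (⊩-all star _) (Π-⇔ λ i → ⇔.trans (⊩-all star _) (Π-⇔ λ j →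
        ⇔.trans (⊩-signed (sameClass? i j) (sameρ i j))
          (mk⇔ (λ e → ⇔.trans e (⊩-sameρ i j)) (λ e → ⇔.trans e (⇔.sym (⊩-sameρ i j))))))
      where
      open Profile π
      Π-⇔ : ∀ {X : Set} {P Q : X → Set} → (∀ x → P x ⇔ Q x) → (∀ x → P x) ⇔ (∀ x → Q x)
      Π-⇔ P⇔Q = mk⇔ (λ p x → to (P⇔Q x) (p x)) (λ q x → from (P⇔Q x) (q x))

    -- A relation, not a function: only tuples whose internal positions are exactly `I` have a block
    -- sequence, and one sequence belongs to many tuples, since the gadget vertex `v` is forgotten.
    data Match : ∀ {q} (I : Subset q) → Vec Vertex q → Vec A.Carrier (blocksLength k I) → Set where
      []    : Match [] [] []
      int∷_ : ∀ {q} {I : Subset q} {a b x} → Match I a b → Match (inside ∷ I) (internal x ∷ a) (x ∷ b)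
      ext∷_ : ∀ {q} {I : Subset q} {a b e v} → Match I a b → Match (outside ∷ I) (external e v ∷ a) (value e ++ᵛ b)

    ⊩-∃blocks : ∀ {q n} {I : Subset q} {xs : Vec (Fin n) q} {κ a as b} {K : Set} →
      Match I as b → Vec.map (lookup a) xs ≡ as →
      (∀ {n′} σ (a′ : Vec Vertex n′) ys → (∀ i → lookup a′ (σ i) ≡ lookup a i) →
        Vec.map (lookup a′) ys ≡ Vec.map internal b → star ⊩ κ n′ σ ys [ a′ ] ⇔ K) →
      star ⊩ ∃blocks I xs κ [ a ] ⇔ K
    ⊩-∃blocks {xs = []}     []       refl spec = spec id _ [] (λ _ → refl) refl
    ⊩-∃blocks {xs = x ∷ xs} (int∷ m) as≡  spec =
      ⊩-∃blocks m (Vec.∷-injectiveʳ as≡) (λ σ a′ ys a′≡ ys≡ →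
        spec σ a′ (σ x ∷ ys) a′≡ (cong₂ _∷_ (trans (a′≡ x) (Vec.∷-injectiveˡ as≡)) ys≡))
    ⊩-∃blocks {n = n} {outside ∷ I} {x ∷ xs} {κ} {a} {_ ∷ as} {K = K} (ext∷_ {b = b} {e} {v} m) as≡ spec = mk⇔
      (λ { (t ∷ ts , ρt , t≡ , h) → forth t ts ρt (trans t≡ (Vec.∷-injectiveˡ as≡)) h })
      (λ h → (external e v ∷ es) , from relation-ρ (e , v , refl , refl) , ≡-sym (Vec.∷-injectiveˡ as≡) , from (inner (external e v)) h)
      where
      open ≡-Reasoning
      es = Vec.map internal (value e)
      body : Guarded Star (suc k + n)
      body = ∃blocks I (Vec.map (suc k ↑ʳ_) xs) (λ _ σ ys → κ _ (σ ∘ (suc k ↑ʳ_)) (Vec.map σ (ρ-variables n) ++ᵛ ys))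
      inner : ∀ t → star ⊩ body [ t ∷ es ++ᵛ a ] ⇔ K
      inner t = ⊩-∃blocks m xs≡ (λ σ a′ ys a′≡ ys≡ → spec (σ ∘ (suc k ↑ʳ_)) a′ _
          (λ i → trans (a′≡ (suc k ↑ʳ i)) (Vec.lookup-++ʳ es a i)) (begin
            Vec.map (lookup a′) (Vec.map σ (ρ-variables n) ++ᵛ ys)
              ≡⟨ Vec.map-++ (lookup a′) (Vec.map σ (ρ-variables n)) ys ⟩
            Vec.map (lookup a′) (Vec.map σ (ρ-variables n)) ++ᵛ Vec.map (lookup a′) ys
              ≡⟨ cong₂ _++ᵛ_ (trans (≡-sym (Vec.map-∘ (lookup a′) σ (ρ-variables n)))
                   (trans (Vec.map-cong a′≡ (ρ-variables n)) (map-lookup-ρ-variables t es a))) ys≡ ⟩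
            es ++ᵛ Vec.map internal b
              ≡⟨ Vec.map-++ internal (value e) b ⟨
            Vec.map internal (value e ++ᵛ b) ∎))
        where
        xs≡ : Vec.map (lookup (t ∷ es ++ᵛ a)) (Vec.map (suc k ↑ʳ_) xs) ≡ as
        xs≡ = begin
          Vec.map (lookup (t ∷ es ++ᵛ a)) (Vec.map (suc k ↑ʳ_) xs)  ≡⟨ Vec.map-∘ (lookup (t ∷ es ++ᵛ a)) (suc k ↑ʳ_) xs ⟨
          Vec.map (lookup (t ∷ es ++ᵛ a) ∘ (suc k ↑ʳ_)) xs          ≡⟨ Vec.map-cong (Vec.lookup-++ʳ es a) xs ⟩
          Vec.map (lookup a) xs                                      ≡⟨ Vec.∷-injectiveʳ as≡ ⟩
          as                                                         ∎
      forth : ∀ t ts → relation ρ (t ∷ ts) → t ≡ external e v → star ⊩ body [ t ∷ ts ++ᵛ a ] → K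
      -- Whatever tuple `near` picks at this external vertex, its tail is forced to be `es`.
      forth t ts ρt t≡ h with f , w , t≡′ , refl ← to relation-ρ ρt
                         with refl ← external-injective (trans (≡-sym t≡) t≡′) = to (inner t) h

    module _ {p} .{{_ : NonZero p}} where

      ⊩-interpretation : ∀ (I : Subset p) φ (local : Local φ) {a b} → Match I a b →
        star ⊩ interpretation I φ local [ a ] ⇔ A ⊨ φ [ b ]
      ⊩-interpretation I φ local@(r , _) {a} {b} m = ⊩-∃blocks m (Vec.map-lookup-allFin a) (λ σ a′ ys _ ys≡ →
        let at : ∀ i → lookup a′ (lookup ys i) ≡ internal (lookup b i)
            at i = trans (≡-sym (Vec.lookup-map i (lookup a′) ys))
                     (trans (cong (λ v → lookup v i) ys≡) (Vec.lookup-map i internal b))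
        in ⇔.trans
          (⊩-relativise (symbols φ) b r i₀ φ id at
            (λ i → trans (at i) (cong internal (≡-sym (BallStructure.lookup-centres A (symbols φ) b r i₀ i)))))
          (⇔.sym (⊨-ball φ local A b i₀)))
        where i₀ = blockVariable I

    ∈R : (e : RTuple) → A.rel R (value e)
    ∈R (e ,ʳ [ e∈ ]) = recompute (A.rel? R e) e∈

    match-inside : ∀ {q} {I : Subset q} {a b i} → Match I a b → i ∈ˢ I → Internal (lookup a i)
    match-inside (int∷_ {x = x} m) Vec.here       = x , refl
    match-inside (int∷ m)          (Vec.there i∈) = match-inside m i∈
    match-inside (ext∷ m)          (Vec.there i∈) = match-inside m i∈

    match-outside : ∀ {q} {I : Subset q} {a b} → Match I a b → ∀ i .(i∉ : i ∉ˢ I) →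
      ∃[ e ] ∃[ v ] lookup a i ≡ external e v × value e ≡ block I b i i∉
    match-outside (int∷ m) zero    i∉ = contradiction-irr i∉ (λ i∉ → i∉ Vec.here)
    match-outside (int∷ m) (suc i) i∉ = match-outside m i (i∉ ∘ Vec.there)
    match-outside (ext∷_ {b = b} {e} {v} m) zero    i∉ = e , v , refl , ≡-sym (take-++ (value e) b)
    match-outside {I = outside ∷ I} (ext∷_ {b = b} {e} m) (suc i) i∉
      with f , v , aᵢ≡ , f≡ ← match-outside m i (i∉ ∘ Vec.there)
      = f , v , aᵢ≡ , trans f≡ (cong (λ b → block I b i (i∉ ∘ Vec.there)) (≡-sym (drop-++ (value e) b)))

    match-exists : ∀ {q} (I : Subset q) a → (∀ i → i ∈ˢ I ⇔ Internal (lookup a i)) → ∃ (Match I a)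
    match-exists []            []                 int = [] , []
    match-exists (inside ∷ I)  (x ∷ a)            int
      with _ , refl ← to (int zero) Vec.here
      with b , m ← match-exists I a (λ i → mk⇔ (to (int (suc i)) ∘ Vec.there) (λ h → drop-there (from (int (suc i)) h))) = _ , int∷ m
    match-exists (outside ∷ I) (internal x ∷ a)   int with () ← from (int zero) (x , refl)
    match-exists (outside ∷ I) (external e v ∷ a) int
      with b , m ← match-exists I a (λ i → mk⇔ (to (int (suc i)) ∘ Vec.there) (λ h → drop-there (from (int (suc i)) h))) = _ , ext∷ m

    HasR : ∀ {q} (I : Subset q) → Pred (Vec A.Carrier (blocksLength k I)) 0ℓ
    HasR I b = ∀ i .(i∉ : i ∉ˢ I) → A.rel R (block I b i i∉)

    module _ {p} (π : Profile p) where
      open Profile π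

      -- A match fixes the internal positions and makes every outside block an `RTuple`. What
      -- remains on either side is which blocks coincide, and blocks are equal exactly when ρ agrees
      -- at the vertices they come from.
      match-profile : ∀ {a b} → Match I a b → HasProfile π a ⇔ Conforms π A b
      match-profile {a} {b} m = mk⇔ forth back
        where
        blocks-sameρ : ∀ i j .(i∉ : i ∉ˢ I) .(j∉ : j ∉ˢ I) →
          block I b i i∉ ≡ block I b j j∉ ⇔ Sameρ (lookup a i) (lookup a j)
        blocks-sameρ i j i∉ j∉ with match-outside m i i∉ | match-outside m j j∉
        ... | e , v , aᵢ≡ , e≡ | f , w , aⱼ≡ , f≡ rewrite aᵢ≡ | aⱼ≡ = mk⇔
          (λ eq → value-injective (trans e≡ (trans eq (≡-sym f≡))))
          (λ eq → trans (≡-sym e≡) (trans (cong value eq) f≡))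

        forth : HasProfile π a → Conforms π A b
        forth (_ , same) =
            (λ i i∉ → let e , _ , _ , e≡ = match-outside m i i∉ in subst (A.rel R) e≡ (∈R e))
          , (λ i j i∉ j∉ → ⇔.trans (blocks-sameρ i j i∉ j∉) (⇔.sym (same i j)))

        ¬internal : ∀ {i} → i ∉ˢ I → ¬ Internal (lookup a i)
        ¬internal {i} i∉ (_ , aᵢ≡) with match-outside m i i∉
        ... | _ , _ , aᵢ≡′ , _ with () ← trans (≡-sym aᵢ≡) aᵢ≡′

        external⇒∉ : ∀ {i e v} → lookup a i ≡ external e v → i ∉ˢ I
        external⇒∉ aᵢ≡ i∈ with match-inside m i∈
        ... | _ , aᵢ≡′ with () ← trans (≡-sym aᵢ≡) aᵢ≡′

        back : Conforms π A b → HasProfile π a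
        back (_ , same) = (λ i → mk⇔ (match-inside m) (internal⇒∈ i)) , λ i j → mk⇔
          (λ (c , i∈ , j∈) → let i∉ = λ i∈I → I-disjoint i c i∈I i∈
                                 j∉ = λ j∈I → I-disjoint j c j∈I j∈
            in to (blocks-sameρ i j i∉ j∉) (from (same i j i∉ j∉) (c , i∈ , j∈)))
          (λ s → let _ , _ , _ , aᵢ≡ , aⱼ≡ = to Sameρ-external s
                     i∉ = external⇒∉ aᵢ≡
                     j∉ = external⇒∉ aⱼ≡
            in to (same i j i∉ j∉) (from (blocks-sameρ i j i∉ j∉) s))
          where
          internal⇒∈ : ∀ i → Internal (lookup a i) → i ∈ˢ I
          internal⇒∈ i int with i ∈ˢ? I
          ... | yes i∈ = i∈
          ... | no i∉  = contradiction int (¬internal i∉)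

    -- Counting tuples by their block sequences

    copies : ∀ {q} → Subset q → ℕ
    copies []            = 1
    copies (inside ∷ I)  = copies I
    copies (outside ∷ I) = length (Finite.elements finiteNonRoot) * copies I

    ∑-vertices : ∀ (f : Vertex → ℕ) → ∑ (Finite.elements finiteVertex) f ≡
      ∑ (Finite.elements A.finite) (f ∘ internal) +
      ∑ (Finite.elements finiteRTuple) (λ e → ∑ (Finite.elements finiteNonRoot) (f ∘ external e))
    ∑-vertices f = trans (∑-++ f (List.map internal (Finite.elements A.finite)) _) (cong₂ _+_
      (∑-map internal f (Finite.elements A.finite))
      (∑-cartesianProductWith external f (Finite.elements finiteRTuple) (Finite.elements finiteNonRoot)))

    -- Each block sequence matches copies I many tuples: the external vertices
    -- range independently over the non-root vertices of the gadget.
    ∑-match : ∀ {q} (I : Subset q) (f : Vec Vertex q → ℕ) (g : Vec A.Carrier (blocksLength k I) → ℕ) →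
      (∀ {a b} → Match I a b → f a ≡ g b) → (∀ a → ¬ ∃ (Match I a) → f a ≡ 0) → (∀ b → ¬ HasR I b → g b ≡ 0) →
      ∑ (tuples finiteVertex q) f ≡ copies I * ∑ (tuples A.finite (blocksLength k I)) g
    ∑-match [] f g match _ _ = cong (_+ 0) (trans (match []) (≡-sym (ℕ.+-identityʳ (g []))))
    ∑-match {suc q} (inside ∷ I) f g match f≡0 g≡0 = begin
      ∑ (tuples finiteVertex (suc q)) f
        ≡⟨ ∑-cartesianProductWith _∷_ f (Finite.elements finiteVertex) as ⟩
      ∑ (Finite.elements finiteVertex) (λ x → ∑ as (f ∘ (x ∷_)))
        ≡⟨ ∑-vertices (λ x → ∑ as (f ∘ (x ∷_))) ⟩
      ∑ xs (λ x → ∑ as (f ∘ (internal x ∷_))) + ∑ (Finite.elements finiteRTuple) (λ e →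
        ∑ (Finite.elements finiteNonRoot) (λ v → ∑ as (f ∘ (external e v ∷_))))
        ≡⟨ cong (∑ xs (λ x → ∑ as (f ∘ (internal x ∷_))) +_)
             -- An external vertex cannot stand at an inside position.
             (∑-zero (λ e → ∑-zero (λ v → ∑-zero (λ a → f≡0 (external e v ∷ a) λ { (_ , ()) }) as)
               (Finite.elements finiteNonRoot)) (Finite.elements finiteRTuple)) ⟩
      ∑ xs (λ x → ∑ as (f ∘ (internal x ∷_))) + 0
        ≡⟨ ℕ.+-identityʳ _ ⟩
      ∑ xs (λ x → ∑ as (f ∘ (internal x ∷_)))
        ≡⟨ ∑-cong (λ x → ∑-match I (f ∘ (internal x ∷_)) (g ∘ (x ∷_)) (match ∘ int∷_)
             (λ a ¬m → f≡0 _ λ { (_ , int∷ m) → ¬m (_ , m) })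
             (λ b ¬r → g≡0 _ λ r → ¬r λ i i∉ → r (suc i) (λ i∈ → i∉ (drop-there i∈)))) xs ⟩
      ∑ xs (λ x → copies I * ∑ bs (g ∘ (x ∷_)))
        ≡⟨ ∑-* (copies I) (λ x → ∑ bs (g ∘ (x ∷_))) xs ⟩
      copies I * ∑ xs (λ x → ∑ bs (g ∘ (x ∷_)))
        ≡⟨ cong (copies I *_) (∑-cartesianProductWith _∷_ g xs bs) ⟨
      copies I * ∑ (tuples A.finite (suc (blocksLength k I))) g ∎
      where
      open ≡-Reasoning
      as = tuples finiteVertex q
      xs = Finite.elements A.finite
      bs = tuples A.finite (blocksLength k I)
    ∑-match {suc q} (outside ∷ I) f g match f≡0 g≡0 = begin
      ∑ (tuples finiteVertex (suc q)) f
        ≡⟨ ∑-cartesianProductWith _∷_ f (Finite.elements finiteVertex) as ⟩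
      ∑ (Finite.elements finiteVertex) (λ x → ∑ as (f ∘ (x ∷_)))
        ≡⟨ ∑-vertices (λ x → ∑ as (f ∘ (x ∷_))) ⟩
      ∑ (Finite.elements A.finite) (λ x → ∑ as (f ∘ (internal x ∷_))) + ∑ es (λ e → ∑ vs (λ v → ∑ as (f ∘ (external e v ∷_))))
        ≡⟨ cong (_+ ∑ es (λ e → ∑ vs (λ v → ∑ as (f ∘ (external e v ∷_)))))
             (∑-zero (λ x → ∑-zero (λ a → f≡0 (internal x ∷ a) λ { (_ , ()) }) as) (Finite.elements A.finite)) ⟩
      ∑ es (λ e → ∑ vs (λ v → ∑ as (f ∘ (external e v ∷_))))
        -- The inner sum does not depend on the gadget vertex, which contributes the factor
        -- `length vs`.
        ≡⟨ ∑-cong (λ e → trans (∑-cong (tail e) vs) (trans (∑-const (copies I * h (value e)) vs)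
             (≡-sym (ℕ.*-assoc (length vs) (copies I) (h (value e)))))) es ⟩
      ∑ es (λ e → copies (outside ∷ I) * h (value e))
        -- A first block outside `R` contributes 0, so the sum may be extended from `RTuple` to all
        -- `k`-tuples, where it recombines with the remaining blocks.
        ≡⟨ ∑-refineList (finiteVec A.finite k) (A.rel? R) (λ u → copies (outside ∷ I) * h u)
             (λ u ¬r → trans (cong (copies (outside ∷ I) *_)
               (∑-zero (λ b → g≡0 _ λ r → ¬r (subst (A.rel R) (take-++ u b) (r zero (λ ())))) bs))
               (ℕ.*-zeroʳ (copies (outside ∷ I)))) (tuples A.finite k) ⟩
      ∑ (tuples A.finite k) (λ u → copies (outside ∷ I) * h u)
        ≡⟨ ∑-* (copies (outside ∷ I)) h (tuples A.finite k) ⟩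
      copies (outside ∷ I) * ∑ (tuples A.finite k) h
        ≡⟨ cong (copies (outside ∷ I) *_) (∑-tuples-++ A.finite k g) ⟨
      copies (outside ∷ I) * ∑ (tuples A.finite (k + blocksLength k I)) g ∎
      where
      open ≡-Reasoning
      as = tuples finiteVertex q
      bs = tuples A.finite (blocksLength k I)
      es = Finite.elements finiteRTuple
      vs = Finite.elements finiteNonRoot
      h : Vec A.Carrier k → ℕ
      h u = ∑ bs (λ b → g (u ++ᵛ b))
      tail : ∀ e v → ∑ as (f ∘ (external e v ∷_)) ≡ copies I * h (value e)
      tail e v = ∑-match I (f ∘ (external e v ∷_)) (g ∘ (value e ++ᵛ_)) (match ∘ ext∷_)
        (λ a ¬m → f≡0 _ λ { (_ , ext∷ m) → ¬m (_ , m) })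
        (λ b ¬r → g≡0 _ λ r → ¬r λ i i∉ → subst (λ b → A.rel R (block I b i i∉)) (drop-++ (value e) b)
          (r (suc i) (λ i∈ → i∉ (drop-there i∈))))

    -- Comparison of the probabilities over `A` and over `A ⋆ G`

    module _ {p} .{{_ : NonZero p}} (π : Profile p) (φ : Formula Base (blocksLength k (Profile.I π))) (local : Local φ) where
      open Profile π
      private
        as = tuples finiteVertex p
        bs = tuples A.finite (blocksLength k I)
        P  = formula (hasProfile π)
        Q  = formula (hasProfile π and interpretation I φ local)

      ⊨-P : ∀ a → star ⊨ P [ a ] ⇔ HasProfile π a
      ⊨-P a = ⇔.trans (⊨-formula star (hasProfile π)) (⊩-hasProfile π)

      ⊨-Q : ∀ a → star ⊨ Q [ a ] ⇔ (HasProfile π a × star ⊩ interpretation I φ local [ a ])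
      ⊨-Q a = ⇔.trans (⊨-formula star (hasProfile π and interpretation I φ local)) (⊩-hasProfile π ×-⇔ ⇔.refl)

      matched : ∀ {a} → HasProfile π a → ∃ (Match I a)
      matched {a} (int , _) = match-exists I a int

      count-P : length (filter (sat? star P) as) ≡ copies I * length (filter (conforms? π A) bs)
      count-P = begin
        length (filter (sat? star P) as)                   ≡⟨ length-filter-∑ (sat? star P) as ⟩
        ∑ as (𝟙 ∘ sat? star P)                             ≡⟨ ∑-match I _ _
          (λ {a} {b} m → 𝟙-cong (⇔.trans (⊨-P a) (match-profile π m)) (sat? star P a) (conforms? π A b))
          (λ a ¬m → 𝟙-no (sat? star P a) (¬m ∘ matched ∘ to (⊨-P a)))
          (λ b ¬r → 𝟙-no (conforms? π A b) (¬r ∘ proj₁)) ⟩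
        copies I * ∑ bs (𝟙 ∘ conforms? π A)                ≡⟨ cong (copies I *_) (length-filter-∑ (conforms? π A) bs) ⟨
        copies I * length (filter (conforms? π A) bs)      ∎
        where open ≡-Reasoning

      count-Q : length (filter (sat? star Q) as) ≡ copies I * length (filter (sat? A φ) (filter (conforms? π A) bs))
      count-Q = begin
        length (filter (sat? star Q) as)                                    ≡⟨ length-filter-∑ (sat? star Q) as ⟩
        ∑ as (𝟙 ∘ sat? star Q)                                              ≡⟨ ∑-match I _ _
          (λ {a} {b} m → 𝟙-cong (⇔.trans (⊨-Q a) (match-profile π m ×-⇔ ⊩-interpretation I φ local m))
            (sat? star Q a) (conforms? π A b ×-dec sat? A φ b))
          (λ a ¬m → 𝟙-no (sat? star Q a) (¬m ∘ matched ∘ proj₁ ∘ to (⊨-Q a)))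
          (λ b ¬r → 𝟙-no (conforms? π A b ×-dec sat? A φ b) (¬r ∘ proj₁ ∘ proj₁)) ⟩
        copies I * ∑ bs (λ b → 𝟙 (conforms? π A b ×-dec sat? A φ b))        ≡⟨ cong (copies I *_)
          (length-filter-filter-∑ (conforms? π A) (sat? A φ) bs) ⟨
        copies I * length (filter (sat? A φ) (filter (conforms? π A) bs))   ∎
        where open ≡-Reasoning

      conditionalProbability-* : conditionalProbability π A φ *ᵠ ⟨ P , star ⟩ ≡ ⟨ Q , star ⟩
      conditionalProbability-* =
        proportion-scaled (sat? star P) (sat? star Q) (sat? A φ) (copies I) as (filter (conforms? π A) bs) count-P count-Q

      ⟨P⟩≡profileProbability : ⟨ P , star ⟩ ≡ profileProbability π
      ⟨P⟩≡profileProbability = proportion-cong (sat? star P) (hasProfile? π) ⊨-P as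

      -- Every tuple of profile π matches some block sequence, which then conforms. Without
      -- conforming sequences the profile would have probability 0.
      conforming : 0ℚ <ᵠ ∣ ⟨ P , star ⟩ ∣ → ∃ (Conforms π A)
      conforming 0<∣P∣ with ∃? (finiteVec A.finite (blocksLength k I)) (conforms? π A)
      ... | yes b = b
      ... | no ¬b = contradiction
        (subst (λ x → 0ℚ <ᵠ ∣ x ∣) (proportion-zero (sat? star P) (λ a h →
          let h = to (⊨-P a) h ; b , m = matched {a} h in ¬b (b , to (match-profile π m) h)) as) 0<∣P∣)
        (ℚ.<-irrefl refl)

-- Convergence of the conditional probabilities

theorem6p1 : (L : Language) (k : ℕ) .{{_ : NonZero k}} (p : ℕ) .{{_ : NonZero p}}
    (A : ℕ → Structure (BaseLanguage L k)) (G : ℕ → Gadget L k) →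
    (∀ n → RootTupleFree (G n)) →
    FOloc-Convergent p (λ n → A n ⋆ G n) →
    (π : Profile p) → NonTrivial π A G →
    (φ : Formula (BaseLanguage L k) (blocksLength k (Profile.I π))) → Local φ →
    ConditionallyConverges π φ A
theorem6p1 L k p A G free converges π (ε , 0<ε , large) φ local =
  let δ , 0<δ , N , δ<∣s∣ = boundedAwayFromZero s (cauchy (hasProfile π)) (ε , 0<ε , ε≤∣s∣)
  in (N , λ n n≥N → C.conforming n π φ local (ℚ.<-trans 0<δ (δ<∣s∣ n n≥N)))
   , cauchy⇒converges c (quotient-cauchy c s _ (λ n → C.conditionalProbability-* n π φ local)
       (λ n → ∣proportion∣≤1 (sat? (A n) φ) (filter (conforms? π (A n)) (tuples (Structure.finite (A n)) _)))
       (cauchy (hasProfile π)) (cauchy (hasProfile π and interpretation (Profile.I π) φ local)) 0<δ δ<∣s∣)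
  where
  module C n = Counting (A n) (G n) (free n)
  c s : ℕ → ℚ
  c n = conditionalProbability π (A n) φ
  s n = ⟨ formula (hasProfile π) , A n ⋆ G n ⟩
  cauchy : (ψ : Guarded (StarLanguage L k) p) → Cauchy (λ n → ⟨ formula ψ , A n ⋆ G n ⟩)
  cauchy ψ = converges⇒cauchy (λ n → ⟨ formula ψ , A n ⋆ G n ⟩) (converges (formula ψ) (guarded-local ψ))
  -- Non-triviality concerns `profileProbability`; here it is carried over to the formula whose
  -- probabilities are known to converge.
  ε≤∣s∣ : ∀ N → ∃[ n ] n ≥ N × ε ≤ᵠ ∣ s n ∣
  ε≤∣s∣ N = let n , n≥N , ε≤ = large N
    in n , n≥N , subst (λ x → ε ≤ᵠ ∣ x ∣) (≡-sym (C.⟨P⟩≡profileProbability n π φ local)) ε≤
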